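{- Let $n$ be even and let $j$ be a positive integer with $\eta := j/n \leq 1/10$. Let $H = J(n,n/2,j)$, let $A$ be its adjacency matrix, let $d = {n/2 \choose j}^2$ (the degree of the regular graph $H$), and let $\tilde{L} = I - A/d$ be the normalised Laplacian of $H$, where $I$ is the ${n \choose n/2}\times{n \choose n/2}$ identity matrix. Let $\tilde{\mu}_1 \leq \tilde{\mu}_2 \leq \dots \leq \tilde{\mu}_{{n \choose n/2}}$ be the eigenvalues of $\tilde{L}$ in increasing order, counted with multiplicity (so $\tilde{\mu}_1 = 0$). Then $$\tilde{\mu}_2 \geq \eta/2.$$
   Context: For $1 \leq j \leq k \leq n$, the Johnson graph $J(n,k,j)$ has vertex set ${[n] \choose k}$ (the $k$-element subsets of $[n]=\{1,\dots,n\}$), with two $k$-sets joined by an edge iff their symmetric difference has size $2j$. -}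

module Defs where

open import Algebra.Bundles using (CommutativeRing)
import Algebra.Properties.Monoid.Sum as MonoidSum
open import Data.Bool.Base using (true; false; if_then_else_)
open import Data.Fin.Base as Fin using (Fin; zero; suc)
import Data.Fin.Properties as Fin
open import Data.Fin.Subset using (Subset; inside; outside; _∈_; ∣_∣; _∪_; _─_; ⊥)
open import Data.Fin.Subset.Properties using (∣⊥∣≡0)
open import Data.Integer.Base as ℤ using (+_)
import Data.Integer.Properties as ℤ
open import Data.Nat.Base as ℕ using (ℕ; zero; suc; NonZero)
open import Data.Nat.Combinatorics using (_C_; nCk+nC[k+1]≡[n+1]C[k+1])
import Data.Nat.DivMod as ℕ
import Data.Nat.Properties as ℕ
open import Data.Product.Base using (Σ; ∃; _×_; _,_; proj₁; proj₂)
open import Data.Rational.Base as ℚ using (ℚ; 0ℚ; 1ℚ; ½; Positive)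
import Data.Rational.Properties as ℚ
open import Data.Rational.Solver using (module +-*-Solver)
import Data.Rational.Unnormalised.Base as ℚᵘ
import Data.Rational.Unnormalised.Properties as ℚᵘ
open import Data.Sum.Base using (_⊎_; inj₁; inj₂)
open import Data.Sum.Function.Propositional using (_⊎-↔_)
open import Data.Vec.Base using ([]; _∷_)
open import Data.Vec.Functional using (Vector)
open import Function.Bundles using (_↔_; _⇔_; Inverse; mk↔ₛ′)
open import Function.Construct.Composition using (_↔-∘_)
open import Level using (0ℓ)
open import Relation.Binary.Definitions using (Decidable)
open import Relation.Binary.PropositionalEquality
  using (_≡_; refl; sym; trans; cong; subst; subst₂)
open import Relation.Nullary.Decidable.Core using (does)

------------------------------------------------------------------------
-- Real numbers: Cauchy sequences of rationals, identified when their
-- difference tends to zero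

Eventually : (ℕ → Set) → Set
Eventually P = ∃ λ N → ∀ n → N ℕ.≤ n → P n

IsCauchy : (ℕ → ℚ) → Set
IsCauchy s = ∀ ε → 0ℚ ℚ.< ε →
  ∃ λ N → ∀ m n → N ℕ.≤ m → N ℕ.≤ n → ℚ.∣ s m ℚ.- s n ∣ ℚ.< ε

record ℝ : Set where
  constructor mkℝ
  field
    seq    : ℕ → ℚ
    cauchy : IsCauchy seq

open ℝ public

infix 4 _≈ᴿ_ _≤ᴿ_

_≈ᴿ_ : ℝ → ℝ → Set
x ≈ᴿ y = ∀ ε → 0ℚ ℚ.< ε → Eventually λ n → ℚ.∣ seq x n ℚ.- seq y n ∣ ℚ.< ε

_≤ᴿ_ : ℝ → ℝ → Set
x ≤ᴿ y = ∀ ε → 0ℚ ℚ.< ε → Eventually λ n → seq x n ℚ.< seq y n ℚ.+ ε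

private
  open +-*-Solver
    using (solve; _:=_; _:+_; _:*_; :-_; _:-_)

  both : ∀ {P Q : ℕ → Set} → Eventually P → Eventually Q →
         Eventually λ n → P n × Q n
  both (M , p) (N , q) = M ℕ.⊔ N , λ n le →
    p n (ℕ.≤-trans (ℕ.m≤m⊔n M N) le) , q n (ℕ.≤-trans (ℕ.m≤n⊔m M N) le)

  both₂ : ∀ {P Q : ℕ → ℕ → Set} →
          (∃ λ N → ∀ m n → N ℕ.≤ m → N ℕ.≤ n → P m n) →
          (∃ λ N → ∀ m n → N ℕ.≤ m → N ℕ.≤ n → Q m n) →
          ∃ λ N → ∀ m n → N ℕ.≤ m → N ℕ.≤ n → P m n × Q m n
  both₂ (M , p) (N , q) = M ℕ.⊔ N , λ m n lm ln →
    p m n (l lm) (l ln) , q m n (r lm) (r ln)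
    where
    l : ∀ {k} → M ℕ.⊔ N ℕ.≤ k → M ℕ.≤ k
    l = ℕ.≤-trans (ℕ.m≤m⊔n M N)
    r : ∀ {k} → M ℕ.⊔ N ℕ.≤ k → N ℕ.≤ k
    r = ℕ.≤-trans (ℕ.m≤n⊔m M N)

  half-pos : ∀ {ε} → 0ℚ ℚ.< ε → 0ℚ ℚ.< ½ ℚ.* ε
  half-pos {ε} p = subst (ℚ._< ½ ℚ.* ε) (ℚ.*-zeroʳ ½) (ℚ.*-monoʳ-<-pos ½ p)

  half+half : ∀ ε → ½ ℚ.* ε ℚ.+ ½ ℚ.* ε ≡ ε
  half+half ε = trans (sym (ℚ.*-distribʳ-+ ε ½ ½)) (ℚ.*-identityˡ ε)

  small-+ : ∀ {a b ε} → ℚ.∣ a ∣ ℚ.< ½ ℚ.* ε → ℚ.∣ b ∣ ℚ.< ½ ℚ.* ε →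
            ℚ.∣ a ℚ.+ b ∣ ℚ.< ε
  small-+ {a} {b} {ε} p q = ℚ.≤-<-trans (ℚ.∣p+q∣≤∣p∣+∣q∣ a b)
    (subst (ℚ.∣ a ∣ ℚ.+ ℚ.∣ b ∣ ℚ.<_) (half+half ε) (ℚ.+-mono-< p q))

  diff-+ : ∀ a b c d → (a ℚ.- c) ℚ.+ (b ℚ.- d) ≡ (a ℚ.+ b) ℚ.- (c ℚ.+ d)
  diff-+ = solve 4 (λ a b c d → (a :- c) :+ (b :- d) := (a :+ b) :- (c :+ d)) refl

  diff-neg : ∀ a b → ℚ.- (a ℚ.- b) ≡ (ℚ.- a) ℚ.- (ℚ.- b)
  diff-neg = solve 2 (λ a b → :- (a :- b) := (:- a) :- (:- b)) refl

  diff-sym : ∀ a b → ℚ.- (a ℚ.- b) ≡ b ℚ.- a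
  diff-sym = solve 2 (λ a b → :- (a :- b) := b :- a) refl

  diff-trans : ∀ a b c → (a ℚ.- b) ℚ.+ (b ℚ.- c) ≡ a ℚ.- c
  diff-trans = solve 3 (λ a b c → (a :- b) :+ (b :- c) := a :- c) refl

  diff-* : ∀ a b c d → a ℚ.* (b ℚ.- d) ℚ.+ (a ℚ.- c) ℚ.* d ≡ a ℚ.* b ℚ.- c ℚ.* d
  diff-* = solve 4 (λ a b c d → a :* (b :- d) :+ (a :- c) :* d := a :* b :- c :* d) refl

  close-+ : ∀ {a b c d ε} → ℚ.∣ a ℚ.- c ∣ ℚ.< ½ ℚ.* ε → ℚ.∣ b ℚ.- d ∣ ℚ.< ½ ℚ.* ε →
            ℚ.∣ (a ℚ.+ b) ℚ.- (c ℚ.+ d) ∣ ℚ.< ε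
  close-+ {a} {b} {c} {d} {ε} p q =
    subst (λ z → ℚ.∣ z ∣ ℚ.< ε) (diff-+ a b c d)
      (small-+ {a ℚ.- c} {b ℚ.- d} p q)

  close-neg : ∀ {a b ε} → ℚ.∣ a ℚ.- b ∣ ℚ.< ε → ℚ.∣ (ℚ.- a) ℚ.- (ℚ.- b) ∣ ℚ.< ε
  close-neg {a} {b} {ε} p =
    subst (ℚ._< ε) (trans (sym (ℚ.∣-p∣≡∣p∣ (a ℚ.- b))) (cong ℚ.∣_∣ (diff-neg a b))) p

  close-refl : ∀ {ε} a → 0ℚ ℚ.< ε → ℚ.∣ a ℚ.- a ∣ ℚ.< ε
  close-refl {ε} a = subst (λ z → ℚ.∣ z ∣ ℚ.< ε) (sym (ℚ.+-inverseʳ a))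

  close-sym : ∀ {a b ε} → ℚ.∣ a ℚ.- b ∣ ℚ.< ε → ℚ.∣ b ℚ.- a ∣ ℚ.< ε
  close-sym {a} {b} {ε} p =
    subst (ℚ._< ε) (trans (sym (ℚ.∣-p∣≡∣p∣ (a ℚ.- b))) (cong ℚ.∣_∣ (diff-sym a b))) p

  close-trans : ∀ {a b c ε} → ℚ.∣ a ℚ.- b ∣ ℚ.< ½ ℚ.* ε → ℚ.∣ b ℚ.- c ∣ ℚ.< ½ ℚ.* ε →
                ℚ.∣ a ℚ.- c ∣ ℚ.< ε
  close-trans {a} {b} {c} {ε} p q =
    subst (λ z → ℚ.∣ z ∣ ℚ.< ε) (diff-trans a b c)
      (small-+ {a ℚ.- b} {b ℚ.- c} p q)

  module Bound (B : ℚ) (0<B : 0ℚ ℚ.< B) where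
    instance
      B-pos : Positive B
      B-pos = ℚ.positive 0<B
      B-nonZero : ℚ.NonZero B
      B-nonZero = ℚ.pos⇒nonZero B
      1/B-pos : Positive (ℚ.1/ B)
      1/B-pos = ℚ.1/pos⇒pos B

    tol : ℚ → ℚ
    tol ε = ℚ.1/ B ℚ.* (½ ℚ.* ε)

    tol-pos : ∀ {ε} → 0ℚ ℚ.< ε → 0ℚ ℚ.< tol ε
    tol-pos {ε} p = subst (ℚ._< tol ε) (ℚ.*-zeroʳ (ℚ.1/ B))
      (ℚ.*-monoʳ-<-pos (ℚ.1/ B) (half-pos p))

    B*tol : ∀ ε → B ℚ.* tol ε ≡ ½ ℚ.* ε
    B*tol ε = trans (sym (ℚ.*-assoc B (ℚ.1/ B) (½ ℚ.* ε)))
      (trans (cong (ℚ._* (½ ℚ.* ε)) (ℚ.*-inverseʳ B)) (ℚ.*-identityˡ _))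

    scale : ∀ {a b ε} → ℚ.∣ a ∣ ℚ.< B → ℚ.∣ b ∣ ℚ.< tol ε → ℚ.∣ a ℚ.* b ∣ ℚ.< ½ ℚ.* ε
    scale {a} {b} {ε} p q = subst (ℚ._< ½ ℚ.* ε) (sym (ℚ.∣p*q∣≡∣p∣*∣q∣ a b))
      (ℚ.≤-<-trans
        (ℚ.*-monoʳ-≤-nonNeg ℚ.∣ b ∣ {{ℚ.nonNegative (ℚ.0≤∣p∣ b)}} (ℚ.<⇒≤ p))
        (subst (B ℚ.* ℚ.∣ b ∣ ℚ.<_) (B*tol ε) (ℚ.*-monoʳ-<-pos B q)))

    close-* : ∀ {a b c d ε} → ℚ.∣ a ∣ ℚ.< B → ℚ.∣ d ∣ ℚ.< B →
              ℚ.∣ a ℚ.- c ∣ ℚ.< tol ε → ℚ.∣ b ℚ.- d ∣ ℚ.< tol ε →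
              ℚ.∣ a ℚ.* b ℚ.- c ℚ.* d ∣ ℚ.< ε
    close-* {a} {b} {c} {d} {ε} pa pd pac pbd =
      subst (λ z → ℚ.∣ z ∣ ℚ.< ε) (diff-* a b c d)
        (small-+ {a ℚ.* (b ℚ.- d)} {(a ℚ.- c) ℚ.* d}
          (scale {a} {b ℚ.- d} {ε} pa pbd)
          (subst (λ z → ℚ.∣ z ∣ ℚ.< ½ ℚ.* ε) (ℚ.*-comm d (a ℚ.- c))
            (scale {d} {a ℚ.- c} {ε} pd pac)))

  0<1 : 0ℚ ℚ.< 1ℚ
  0<1 = ℚ.positive⁻¹ 1ℚ

  bound-pos : ∀ b → 0ℚ ℚ.< ℚ.∣ b ∣ ℚ.+ 1ℚ
  bound-pos b = subst (ℚ._< ℚ.∣ b ∣ ℚ.+ 1ℚ) (ℚ.+-identityʳ 0ℚ)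
    (ℚ.+-mono-≤-< {0ℚ} {ℚ.∣ b ∣} {0ℚ} {1ℚ} (ℚ.0≤∣p∣ b) 0<1)

  near-bound : ∀ a b → ℚ.∣ a ℚ.- b ∣ ℚ.< 1ℚ → ℚ.∣ a ∣ ℚ.< ℚ.∣ b ∣ ℚ.+ 1ℚ
  near-bound a b p = ℚ.≤-<-trans {ℚ.∣ a ∣} {ℚ.∣ b ∣ ℚ.+ ℚ.∣ a ℚ.- b ∣} {ℚ.∣ b ∣ ℚ.+ 1ℚ}
    (subst (λ z → ℚ.∣ z ∣ ℚ.≤ ℚ.∣ b ∣ ℚ.+ ℚ.∣ a ℚ.- b ∣)
      (cancel a b) (ℚ.∣p+q∣≤∣p∣+∣q∣ b (a ℚ.- b)))
    (ℚ.+-monoʳ-< ℚ.∣ b ∣ {ℚ.∣ a ℚ.- b ∣} {1ℚ} p)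
    where
    cancel : ∀ a b → b ℚ.+ (a ℚ.- b) ≡ a
    cancel = solve 2 (λ a b → b :+ (a :- b) := a) refl

  bounded : ∀ x → ∃ λ B → 0ℚ ℚ.< B × Eventually λ n → ℚ.∣ seq x n ∣ ℚ.< B
  bounded x =
    let N , p = cauchy x 1ℚ 0<1
    in ℚ.∣ seq x N ∣ ℚ.+ 1ℚ , bound-pos (seq x N) , N ,
       λ n le → near-bound (seq x n) (seq x N) (p n N le ℕ.≤-refl)

  bounded₂ : ∀ x y → ∃ λ B → 0ℚ ℚ.< B ×
             Eventually λ n → ℚ.∣ seq x n ∣ ℚ.< B × ℚ.∣ seq y n ∣ ℚ.< B
  bounded₂ x y =
    let B , 0<B , p = bounded x
        C , 0<C , q = bounded y
        N , r = both p q
    in B ℚ.⊔ C , ℚ.<-≤-trans {0ℚ} {B} {B ℚ.⊔ C} 0<B (ℚ.p≤p⊔q B C) , N , λ n le →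
      ℚ.<-≤-trans {ℚ.∣ seq x n ∣} {B} {B ℚ.⊔ C} (proj₁ (r n le)) (ℚ.p≤p⊔q B C) ,
      ℚ.<-≤-trans {ℚ.∣ seq y n ∣} {C} {B ℚ.⊔ C} (proj₂ (r n le)) (ℚ.p≤q⊔p B C)

infixl 6 _+ᴿ_
infixl 7 _*ᴿ_
infix  8 -ᴿ_

_+ᴿ_ : ℝ → ℝ → ℝ
x +ᴿ y = mkℝ (λ n → seq x n ℚ.+ seq y n) λ ε 0<ε →
  let N , p = both₂ (cauchy x (½ ℚ.* ε) (half-pos 0<ε))
                    (cauchy y (½ ℚ.* ε) (half-pos 0<ε))
  in N , λ m n lm ln →
    close-+ {seq x m} {seq y m} {seq x n} {seq y n}
      (proj₁ (p m n lm ln)) (proj₂ (p m n lm ln))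

-ᴿ_ : ℝ → ℝ
-ᴿ x = mkℝ (λ n → ℚ.- seq x n) λ ε 0<ε →
  let N , p = cauchy x ε 0<ε
  in N , λ m n lm ln → close-neg {seq x m} {seq x n} (p m n lm ln)

_*ᴿ_ : ℝ → ℝ → ℝ
x *ᴿ y = mkℝ (λ n → seq x n ℚ.* seq y n) λ ε 0<ε →
  let B , 0<B , M , b = bounded₂ x y
      open Bound B 0<B
      N , p = both₂ (M , λ m n lm ln → proj₁ (b m lm) , proj₂ (b n ln))
                    (both₂ (cauchy x (tol ε) (tol-pos 0<ε))
                           (cauchy y (tol ε) (tol-pos 0<ε)))
  in N , λ m n lm ln →
    let (bx , by) , cx , cy = p m n lm ln
    in close-* {seq x m} {seq y m} {seq x n} {seq y n} bx by cx cy

fromℚ : ℚ → ℝ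
fromℚ q = mkℝ (λ _ → q) λ ε 0<ε → 0 , λ _ _ _ _ → close-refl q 0<ε

private
  ≗⇒≈ : ∀ {x y} → (∀ n → seq x n ≡ seq y n) → x ≈ᴿ y
  ≗⇒≈ {x} {y} e ε 0<ε = 0 , λ n _ →
    subst (λ z → ℚ.∣ seq x n ℚ.- z ∣ ℚ.< ε) (e n) (close-refl (seq x n) 0<ε)

  ≈-sym : ∀ {x y} → x ≈ᴿ y → y ≈ᴿ x
  ≈-sym {x} {y} e ε 0<ε =
    let N , p = e ε 0<ε in N , λ n le → close-sym {seq x n} {seq y n} (p n le)

  ≈-trans : ∀ {x y z} → x ≈ᴿ y → y ≈ᴿ z → x ≈ᴿ z
  ≈-trans {x} {y} {z} e f ε 0<ε =
    let N , p = both (e (½ ℚ.* ε) (half-pos 0<ε)) (f (½ ℚ.* ε) (half-pos 0<ε))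
    in N , λ n le → close-trans {seq x n} {seq y n} {seq z n} (proj₁ (p n le)) (proj₂ (p n le))

  +-cong-≈ : ∀ {x x′ y y′} → x ≈ᴿ x′ → y ≈ᴿ y′ → x +ᴿ y ≈ᴿ x′ +ᴿ y′
  +-cong-≈ {x} {x′} {y} {y′} e f ε 0<ε =
    let N , p = both (e (½ ℚ.* ε) (half-pos 0<ε)) (f (½ ℚ.* ε) (half-pos 0<ε))
    in N , λ n le → close-+ {seq x n} {seq y n} {seq x′ n} {seq y′ n}
                      (proj₁ (p n le)) (proj₂ (p n le))

  neg-cong-≈ : ∀ {x y} → x ≈ᴿ y → -ᴿ x ≈ᴿ -ᴿ y
  neg-cong-≈ {x} {y} e ε 0<ε =
    let N , p = e ε 0<ε in N , λ n le → close-neg {seq x n} {seq y n} (p n le)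

  *-cong-≈ : ∀ {x x′ y y′} → x ≈ᴿ x′ → y ≈ᴿ y′ → x *ᴿ y ≈ᴿ x′ *ᴿ y′
  *-cong-≈ {x} {x′} {y} {y′} e f ε 0<ε =
    let B , 0<B , b = bounded₂ x y′
        open Bound B 0<B
        N , p = both b (both (e (tol ε) (tol-pos 0<ε)) (f (tol ε) (tol-pos 0<ε)))
    in N , λ n le →
      let (bx , by) , ex , ey = p n le
      in close-* {seq x n} {seq y n} {seq x′ n} {seq y′ n} bx by ex ey

ℝ-commutativeRing : CommutativeRing 0ℓ 0ℓ
ℝ-commutativeRing = record
  { Carrier = ℝ
  ; _≈_ = _≈ᴿ_
  ; _+_ = _+ᴿ_
  ; _*_ = _*ᴿ_
  ; -_ = -ᴿ_
  ; 0# = fromℚ 0ℚ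
  ; 1# = fromℚ 1ℚ
  ; isCommutativeRing = record
    { isRing = record
      { +-isAbelianGroup = record
        { isGroup = record
          { isMonoid = record
            { isSemigroup = record
              { isMagma = record
                { isEquivalence = record
                  { refl = λ {x} → ≗⇒≈ {x} {x} λ _ → refl
                  ; sym = λ {x} {y} → ≈-sym {x} {y}
                  ; trans = λ {x} {y} {z} → ≈-trans {x} {y} {z}
                  }
                ; ∙-cong = λ {x} {x′} {y} {y′} → +-cong-≈ {x} {x′} {y} {y′}
                }
              ; assoc = λ x y z → ≗⇒≈ {(x +ᴿ y) +ᴿ z} {x +ᴿ (y +ᴿ z)}
                  λ n → ℚ.+-assoc (seq x n) (seq y n) (seq z n)
              }
            ; identity =
                (λ x → ≗⇒≈ {fromℚ 0ℚ +ᴿ x} {x} λ n → ℚ.+-identityˡ (seq x n))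
              , (λ x → ≗⇒≈ {x +ᴿ fromℚ 0ℚ} {x} λ n → ℚ.+-identityʳ (seq x n))
            }
          ; inverse =
              (λ x → ≗⇒≈ {(-ᴿ x) +ᴿ x} {fromℚ 0ℚ} λ n → ℚ.+-inverseˡ (seq x n))
            , (λ x → ≗⇒≈ {x +ᴿ (-ᴿ x)} {fromℚ 0ℚ} λ n → ℚ.+-inverseʳ (seq x n))
          ; ⁻¹-cong = λ {x} {y} → neg-cong-≈ {x} {y}
          }
        ; comm = λ x y → ≗⇒≈ {x +ᴿ y} {y +ᴿ x} λ n → ℚ.+-comm (seq x n) (seq y n)
        }
      ; *-cong = λ {x} {x′} {y} {y′} → *-cong-≈ {x} {x′} {y} {y′}
      ; *-assoc = λ x y z → ≗⇒≈ {(x *ᴿ y) *ᴿ z} {x *ᴿ (y *ᴿ z)}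
          λ n → ℚ.*-assoc (seq x n) (seq y n) (seq z n)
      ; *-identity =
          (λ x → ≗⇒≈ {fromℚ 1ℚ *ᴿ x} {x} λ n → ℚ.*-identityˡ (seq x n))
        , (λ x → ≗⇒≈ {x *ᴿ fromℚ 1ℚ} {x} λ n → ℚ.*-identityʳ (seq x n))
      ; distrib =
          (λ x y z → ≗⇒≈ {x *ᴿ (y +ᴿ z)} {x *ᴿ y +ᴿ x *ᴿ z}
            λ n → ℚ.*-distribˡ-+ (seq x n) (seq y n) (seq z n))
        , (λ x y z → ≗⇒≈ {(y +ᴿ z) *ᴿ x} {y *ᴿ x +ᴿ z *ᴿ x}
            λ n → ℚ.*-distribʳ-+ (seq x n) (seq y n) (seq z n))
      }
    ; *-comm = λ x y → ≗⇒≈ {x *ᴿ y} {y *ᴿ x} λ n → ℚ.*-comm (seq x n) (seq y n)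
    }
  }

open CommutativeRing ℝ-commutativeRing public
  using () renaming (0# to 0ᴿ; 1# to 1ᴿ; _-_ to _-ᴿ_)

open MonoidSum (CommutativeRing.+-monoid ℝ-commutativeRing) public
  using () renaming (sum to sumᴿ)

------------------------------------------------------------------------
-- Real square matrices and their eigenvalues

Matrix : ℕ → Set
Matrix N = Fin N → Fin N → ℝ

identity : ∀ {N} → Matrix N
identity i j = if does (i Fin.≟ j) then 1ᴿ else 0ᴿ

infixl 6 _-ᴹ_
infixr 7 _·ᴹ_
infixr 7 _*ᵥ_

_-ᴹ_ : ∀ {N} → Matrix N → Matrix N → Matrix N
(M -ᴹ M′) i j = M i j -ᴿ M′ i j

_·ᴹ_ : ∀ {N} → ℝ → Matrix N → Matrix N
(c ·ᴹ M) i j = c *ᴿ M i j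

_*ᵥ_ : ∀ {N} → Matrix N → Vector ℝ N → Vector ℝ N
(M *ᵥ x) i = sumᴿ λ j → M i j *ᴿ x j

linearCombination : ∀ {m N} → Vector ℝ m → (Fin m → Vector ℝ N) → Vector ℝ N
linearCombination c b i = sumᴿ λ k → c k *ᴿ b k i

LinearlyIndependent : ∀ {m N} → (Fin m → Vector ℝ N) → Set
LinearlyIndependent b =
  ∀ c → (∀ i → linearCombination c b i ≈ᴿ 0ᴿ) → ∀ k → c k ≈ᴿ 0ᴿ

HasDimension : ∀ {N} → (Vector ℝ N → Set) → ℕ → Set
HasDimension {N} E m = ∃ λ (b : Fin m → Vector ℝ N) →
  (∀ k → E (b k)) ×
  LinearlyIndependent b ×
  (∀ x → E x → ∃ λ c → ∀ i → x i ≈ᴿ linearCombination c b i)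

Eigenspace : ∀ {N} → Matrix N → ℝ → Vector ℝ N → Set
Eigenspace M t x = ∀ i → (M *ᵥ x) i ≈ᴿ t *ᴿ x i

-- Every real t occurs in the list μ exactly dim ker (M - t I) times, and so
-- does not occur unless it is an eigenvalue.  For symmetric M there is no
-- difference between this multiplicity and the algebraic one.  Equality of
-- reals is undecidable, so the occurrences of t are given as a subset S
-- rather than counted by a function.
EigenvaluesWithMultiplicity : ∀ {N} → Matrix N → Vector ℝ N → Set
EigenvaluesWithMultiplicity {N} M μ =
  ∀ t (S : Subset N) → (∀ i → i ∈ S ⇔ μ i ≈ᴿ t) →
  HasDimension (Eigenspace M t) ∣ S ∣

Increasing : ∀ {N} → Vector ℝ N → Set
Increasing μ = ∀ {i j} → i Fin.≤ j → μ i ≤ᴿ μ j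

------------------------------------------------------------------------
-- Johnson graphs

KSubset : ℕ → ℕ → Set
KSubset n k = Σ (Subset n) λ S → ∣ S ∣ ≡ k

infixl 6 _△_

_△_ : ∀ {n} → Subset n → Subset n → Subset n
S △ T = (S ─ T) ∪ (T ─ S)

JohnsonAdjacent : ∀ n k → ℕ → KSubset n k → KSubset n k → Set
JohnsonAdjacent n k j (S , _) (T , _) = ∣ S △ T ∣ ≡ 2 ℕ.* j

johnsonAdjacent? : ∀ n k j → Decidable (JohnsonAdjacent n k j)
johnsonAdjacent? n k j (S , _) (T , _) = ∣ S △ T ∣ ℕ.≟ 2 ℕ.* j

private
  ksubset-≡ : ∀ {n k} {p q : KSubset n k} → proj₁ p ≡ proj₁ q → p ≡ q
  ksubset-≡ {p = S , a} {q = .S , b} refl = cong (S ,_) (ℕ.≡-irrelevant a b)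

  empty : ∀ n → KSubset n 0
  empty n = ⊥ , ∣⊥∣≡0 n

  empty-unique : ∀ {n} (S : Subset n) → ∣ S ∣ ≡ 0 → ⊥ ≡ S
  empty-unique []          _  = refl
  empty-unique (false ∷ S) eq = cong (outside ∷_) (empty-unique S eq)

  one↔ : ∀ n → Fin 1 ↔ KSubset n 0
  one↔ n = mk↔ₛ′ (λ _ → empty n) (λ _ → zero)
    (λ (S , eq) → ksubset-≡ (empty-unique S eq)) λ { zero → refl }

  none↔ : ∀ k → Fin 0 ↔ KSubset 0 (suc k)
  none↔ k = mk↔ₛ′ (λ ()) (λ { ([] , ()) }) (λ { ([] , ()) }) λ ()

  split↔ : ∀ n k → (KSubset n k ⊎ KSubset n (suc k)) ↔ KSubset (suc n) (suc k)
  split↔ n k = mk↔ₛ′ to from to∘from from∘to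
    where
    to : KSubset n k ⊎ KSubset n (suc k) → KSubset (suc n) (suc k)
    to (inj₁ (S , eq)) = inside ∷ S , cong suc eq
    to (inj₂ (S , eq)) = outside ∷ S , eq
    from : KSubset (suc n) (suc k) → KSubset n k ⊎ KSubset n (suc k)
    from (true  ∷ S , eq) = inj₁ (S , ℕ.suc-injective eq)
    from (false ∷ S , eq) = inj₂ (S , eq)
    to∘from : ∀ p → to (from p) ≡ p
    to∘from (true  ∷ S , eq) = ksubset-≡ refl
    to∘from (false ∷ S , eq) = refl
    from∘to : ∀ p → from (to p) ≡ p
    from∘to (inj₁ _) = cong inj₁ (ksubset-≡ refl)
    from∘to (inj₂ _) = refl

vertices : ∀ n k → Fin (n C k) ↔ KSubset n k
vertices n       zero    = one↔ n
vertices zero    (suc k) = none↔ k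
vertices (suc n) (suc k) =
  subst (λ m → Fin m ↔ KSubset (suc n) (suc k)) (nCk+nC[k+1]≡[n+1]C[k+1] n k)
    (split↔ n k ↔-∘ ((vertices n k ⊎-↔ vertices n (suc k)) ↔-∘ Fin.+↔⊎))

johnsonAdjacencyMatrix : ∀ n k → ℕ → Matrix (n C k)
johnsonAdjacencyMatrix n k j p q =
  if does (johnsonAdjacent? n k j (vertex p) (vertex q)) then 1ᴿ else 0ᴿ
  where
  vertex : Fin (n C k) → KSubset n k
  vertex = Inverse.to (vertices n k)

private
  C-positive : ∀ {n k} → k ℕ.≤ n → 0 ℕ.< n C k
  C-positive {n} {zero} _ = ℕ.≤-refl
  C-positive {suc n} {suc k} (ℕ.s≤s k≤n) =
    subst (0 ℕ.<_) (nCk+nC[k+1]≡[n+1]C[k+1] n k)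
      (ℕ.≤-trans (C-positive k≤n) (ℕ.m≤m+n (n C k) (n C suc k)))

  1<C : ∀ {n k} → 0 ℕ.< k → k ℕ.< n → 1 ℕ.< n C k
  1<C {suc n} {suc k} _ (ℕ.s≤s k<n) =
    subst (1 ℕ.<_) (nCk+nC[k+1]≡[n+1]C[k+1] n k)
      (ℕ.+-mono-≤ (C-positive (ℕ.<⇒≤ k<n)) (C-positive k<n))

-- The degree of J(2k,k,j).
degree : ℕ → ℕ → ℕ
degree k j = (k C j) ℕ.^ 2

degree-nonZero : ∀ {k j} → j ℕ.≤ k → NonZero (degree k j)
degree-nonZero {k} {j} j≤k = ℕ.m^n≢0 (k C j) 2 {{ℕ.>-nonZero (C-positive j≤k)}}

normalisedLaplacian : ∀ n j → j ℕ.≤ n ℕ./ 2 → Matrix (n C (n ℕ./ 2))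
normalisedLaplacian n j j≤n/2 =
  identity -ᴹ fromℚ (+ 1 ℚ./ d) ·ᴹ johnsonAdjacencyMatrix n (n ℕ./ 2) j
  where
  d = degree (n ℕ./ 2) j
  instance
    d≢0 : NonZero d
    d≢0 = degree-nonZero j≤n/2

module _ {n j : ℕ} .{{_ : NonZero n}} (η≤1/10 : + j ℚ./ n ℚ.≤ + 1 ℚ./ 10) where
  private
    10j≤n : ∀ n .{{_ : NonZero n}} → + j ℚ./ n ℚ.≤ + 1 ℚ./ 10 → j ℕ.* 10 ℕ.≤ n
    10j≤n (suc n) le
      with ℚᵘ.*≤* p ← ℚᵘ.≤-respˡ-≃ (ℚ.toℚᵘ-fromℚᵘ (ℚᵘ.mkℚᵘ (+ j) n)) (ℚ.toℚᵘ-mono-≤ le) =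
      subst (j ℕ.* 10 ℕ.≤_) (ℕ.*-identityˡ (suc n))
        (ℤ.drop‿+≤+ (subst₂ ℤ._≤_ (sym (ℤ.pos-* j 10)) (sym (ℤ.pos-* 1 (suc n))) p))

  j≤n/2 : j ℕ.≤ n ℕ./ 2
  j≤n/2 = subst (ℕ._≤ n ℕ./ 2) (ℕ.m*n/n≡m j 2)
    (ℕ./-monoˡ-≤ 2 (ℕ.≤-trans (ℕ.*-monoʳ-≤ j {2} {10} (ℕ.s≤s (ℕ.s≤s ℕ.z≤n))) (10j≤n n η≤1/10)))

  1<number-of-vertices : .{{NonZero j}} → 1 ℕ.< n C (n ℕ./ 2)
  1<number-of-vertices =
    1<C (ℕ.≤-trans (ℕ.>-nonZero⁻¹ j) j≤n/2) (ℕ.m/n<m n 2 ℕ.≤-refl)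

{-# OPTIONS --safe #-}

-- Swapping the coordinates p and p + 1 is an automorphism π of the Johnson
-- graph.  If x is an eigenvector of the Laplacian with eigenvalue t, then so is
-- y = x - x ∘ π, and y vanishes at every vertex that contains both or neither of
-- p and p + 1.  At a vertex where |y| is largest this gives 1 - t ≤ m / d, where
-- m is the number of neighbours that contain exactly one of p and p + 1.  With
-- n = 2k one has m = C(k-1,j)² + C(k-1,j-1)² and hence m / d ≤ 1 - j/k = 1 - 2η.
-- So for t < η the vector x is invariant under all swaps, that is, constant, and
-- at most one eigenvalue, counted with multiplicity, is below η.
--
-- The argument runs on the rational approximations of x and t, where maxima
-- exist and the eigenvector equation holds up to a small residual.
module Submission where

open import Defs
open import Algebra.Bundles using (CommutativeRing)
import Algebra.Properties.CommutativeMonoid.Sum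
import Algebra.Properties.CommutativeSemigroup
import Algebra.Properties.Group
import Algebra.Properties.Monoid.Sum
import Algebra.Properties.Ring
import Algebra.Properties.Semiring.Sum
open import Data.Bool.Base using (Bool; true; false; _∧_; _xor_; if_then_else_)
open import Data.Bool.Properties as Bool using (∧-zeroʳ)
open import Data.Empty using (⊥-elim)
open import Data.Fin.Base as Fin using (Fin; zero; suc; fromℕ<; toℕ)
open import Data.Fin.Permutation using (Permutation′; _⟨$⟩ʳ_)
import Data.Fin.Properties as Fin
open import Data.Fin.Subset using (Subset; ∣_∣; _─_; _∈_)
open import Data.Fin.Subset.Properties using (x∈p⇒∣p-x∣<∣p∣; x∈p∧x≢y⇒x∈p-y)
open import Data.Integer.Base as ℤ using (+_)
import Data.Integer.Properties as ℤ
open import Data.List.Base using (allFin)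
import Data.List.Extrema as Extrema
open import Data.List.Membership.Propositional.Properties using (∈-allFin)
import Data.List.Relation.Unary.All as All
open import Data.Nat.Base as ℕ using (ℕ; zero; suc; NonZero)
open import Data.Nat.Combinatorics using (_C_; nC1≡n; nCk+nC[k+1]≡[n+1]C[k+1])
open import Data.Nat.DivMod using (m/n*n≡m)
open import Data.Nat.Divisibility using (_∣_)
import Data.Nat.Properties as ℕ
open import Data.Nat.Solver renaming (module +-*-Solver to ℕ-Solver)
open import Data.Product.Base using (∃; _×_; _,_; proj₁; proj₂)
open import Data.Rational.Base as ℚ using (ℚ; 0ℚ; 1ℚ; ½)
import Data.Rational.Properties as ℚ
open import Data.Rational.Solver renaming (module +-*-Solver to ℚ-Solver)
import Data.Rational.Unnormalised.Base as ℚᵘ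
import Data.Rational.Unnormalised.Properties as ℚᵘ
open import Data.Sum.Base using (inj₁; inj₂)
open import Data.Vec.Base using ([]; _∷_; tabulate)
open import Data.Vec.Functional using (Vector)
open import Data.Vec.Properties
  using (≡-dec; ∷-injectiveʳ; lookup∘tabulate; lookup⇒[]=; []=⇒lookup)
open import Effect.Monad using (RawMonad)
open import Function.Base using (_∘_; case_of_)
open import Function.Bundles using (_↔_; _⇔_; Inverse; Equivalence; mk↔ₛ′; mk⇔)
open import Function.Construct.Composition using (_↔-∘_)
open import Function.Construct.Symmetry using (↔-sym)
open import Function.Definitions using (Injective)
open import Relation.Binary.Bundles using (DecTotalOrder)
open import Relation.Binary.PropositionalEquality
  using (_≡_; _≢_; refl; sym; trans; cong; cong₂; subst; subst₂; module ≡-Reasoning)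
import Relation.Binary.Reasoning.Setoid
open import Relation.Nullary.Decidable
  using (Dec; yes; no; does; dec-true; dec-false; ¬¬-excluded-middle)
open import Relation.Nullary.Negation using (¬_; contradiction; ¬¬-Monad)

-- Linear algebra over a commutative ring: constant vectors

module Coefficients {c ℓ} (R : CommutativeRing c ℓ) where
  open CommutativeRing R hiding (zero; refl; sym; trans)
  open CommutativeRing R using () renaming (sym to ≈-sym; trans to ≈-trans)
  open Algebra.Properties.Ring ring using (-‿distribˡ-*)
  open Algebra.Properties.Group +-group using (x∙y⁻¹≈ε⇒x≈y; ⁻¹-injective; ε⁻¹≈ε)
  open Algebra.Properties.CommutativeMonoid.Sum +-commutativeMonoid using (sum; sum-cong-≋)
  open Algebra.Properties.Monoid.Sum +-monoid using (sum-replicate-zero)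
  open Algebra.Properties.Semiring.Sum semiring using (*-distribʳ-sum)
  open Relation.Binary.Reasoning.Setoid setoid

  combination : ∀ {m N} → (Fin m → Carrier) → (Fin m → Fin N → Carrier) → Fin N → Carrier
  combination c b i = sum λ k → c k * b k i

  Independent : ∀ {m N} → (Fin m → Fin N → Carrier) → Set _
  Independent b = ∀ c → (∀ i → combination c b i ≈ 0#) → ∀ k → c k ≈ 0#

  private
    zero-combination : ∀ {m N} (b : Fin m → Fin N → Carrier) i → combination (λ _ → 0#) b i ≈ 0#
    zero-combination {m} b i = begin
      sum (λ k → 0# * b k i) ≈⟨ sum-cong-≋ (λ k → zeroˡ (b k i)) ⟩
      sum {m} (λ _ → 0#)     ≈⟨ sum-replicate-zero m ⟩
      0#                     ∎

  -- The coefficients 1, 0, ..., 0 give a vanishing combination, so independence makes the first of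
  -- them zero. The conclusion is `1# ≈ 0#` because an arbitrary ring may be trivial; over `ℝ` it is
  -- absurd.
  independent∧head≈0⇒1≈0 : ∀ {m N} {b : Fin (suc m) → Fin N → Carrier} → Independent b →
                       (∀ i → b zero i ≈ 0#) → 1# ≈ 0#
  independent∧head≈0⇒1≈0 {m} {b = b} ind b₀≈0 = ind e comb zero
    where
    e : Fin (suc m) → Carrier
    e zero    = 1#
    e (suc _) = 0#
    comb : ∀ i → combination e b i ≈ 0#
    comb i = begin
      1# * b zero i + combination (λ _ → 0#) (b ∘ suc) i
        ≈⟨ +-cong (≈-trans (*-identityˡ _) (b₀≈0 i)) (zero-combination (b ∘ suc) i) ⟩
      0# + 0#  ≈⟨ +-identityˡ 0# ⟩
      0#       ∎

  -- Constant vectors with values s and t satisfy t b₀ - s b₁ = 0, so independence makes the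
  -- coefficient - s zero. This relation needs no division and no decision whether s vanishes.
  constant-pair-dependent : ∀ {m N} {b : Fin (2 ℕ.+ m) → Fin N → Carrier} → Independent b → ∀ v →
    (∀ i → b zero i ≈ b zero v) → (∀ i → b (suc zero) i ≈ b (suc zero) v) → b zero v ≈ 0#
  constant-pair-dependent {m} {b = b} ind v const₀ const₁ =
    ⁻¹-injective (≈-trans (ind e comb (suc zero)) (≈-sym ε⁻¹≈ε))
    where
    e : Fin (2 ℕ.+ m) → Carrier
    e zero          = b (suc zero) v
    e (suc zero)    = - b zero v
    e (suc (suc _)) = 0#
    comb : ∀ i → combination e b i ≈ 0#
    comb i = begin
      b (suc zero) v * b zero i + (- b zero v * b (suc zero) i + combination {m} (λ _ → 0#) (λ k → b (suc (suc k))) i)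
        ≈⟨ +-cong (*-congˡ (const₀ i)) (+-cong (*-congˡ (const₁ i)) (zero-combination {m} (λ k → b (suc (suc k))) i)) ⟩
      b (suc zero) v * b zero v + (- b zero v * b (suc zero) v + 0#)
        ≈⟨ +-cong (*-comm _ _) (≈-trans (+-identityʳ _) (≈-sym (-‿distribˡ-* _ _))) ⟩
      b zero v * b (suc zero) v + - (b zero v * b (suc zero) v)
        ≈⟨ -‿inverseʳ _ ⟩
      0# ∎

  -- On a constant vector the matrix acts as multiplication by the row sum. The factor `x v` stays,
  -- to be cancelled once it is known to be nonzero.
  constant-eigenvector : ∀ {N} (a x : Fin N → Carrier) {t} v → (∀ w → x w ≈ x v) →
    sum (λ w → a w * x w) ≈ t * x v → (t - sum a) * x v ≈ 0#
  constant-eigenvector a x {t} v const eig = begin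
    (t + - sum a) * x v           ≈⟨ distribʳ (x v) t (- sum a) ⟩
    t * x v + - sum a * x v       ≈⟨ +-congˡ (≈-sym (-‿distribˡ-* (sum a) (x v))) ⟩
    t * x v + - (sum a * x v)     ≈⟨ +-cong (≈-sym eig) (-‿cong (*-distribʳ-sum (x v) a)) ⟩
    sum (λ w → a w * x w) + - sum (λ w → a w * x v)
      ≈⟨ +-congˡ (-‿cong (sum-cong-≋ λ w → *-congˡ (≈-sym (const w)))) ⟩
    sum (λ w → a w * x w) + - sum (λ w → a w * x w)
      ≈⟨ -‿inverseʳ _ ⟩
    0# ∎

  x-y≈0⇒x≈y : ∀ x y → x - y ≈ 0# → x ≈ y
  x-y≈0⇒x≈y = x∙y⁻¹≈ε⇒x≈y

-- Counting subsets

open Algebra.Properties.CommutativeSemigroup ℕ.+-commutativeSemigroup using (x∙yz≈y∙xz)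
module ℕ∑ = Algebra.Properties.CommutativeMonoid.Sum ℕ.+-0-commutativeMonoid

-- The position is an unbounded natural number. Where position `i + 1` does not exist, nothing moves
-- and `separates` is false, so the lemmas below carry no range condition.
swap : ∀ {n} → ℕ → Subset n → Subset n
swap _       []          = []
swap zero    (x ∷ [])    = x ∷ []
swap zero    (x ∷ y ∷ S) = y ∷ x ∷ S
swap (suc i) (x ∷ S)     = x ∷ swap i S

separates : ∀ {n} → ℕ → Subset n → Bool
separates _       []          = false
separates zero    (x ∷ [])    = false
separates zero    (x ∷ y ∷ S) = x xor y
separates (suc i) (x ∷ S)     = separates i S

swap-involutive : ∀ {n} i (S : Subset n) → swap i (swap i S) ≡ S
swap-involutive _       []          = refl
swap-involutive zero    (x ∷ [])    = refl
swap-involutive zero    (x ∷ y ∷ S) = refl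
swap-involutive (suc i) (x ∷ S)     = cong (x ∷_) (swap-involutive i S)

swap-fixed : ∀ {n} i (S : Subset n) → separates i S ≡ false → swap i S ≡ S
swap-fixed _       []                  _ = refl
swap-fixed zero    (x ∷ [])            _ = refl
swap-fixed zero    (true  ∷ true  ∷ S) _ = refl
swap-fixed zero    (false ∷ false ∷ S) _ = refl
swap-fixed (suc i) (x ∷ S)             e = cong (x ∷_) (swap-fixed i S e)

∣swap∣ : ∀ {n} i (S : Subset n) → ∣ swap i S ∣ ≡ ∣ S ∣
∣swap∣ _       []                  = refl
∣swap∣ zero    (x ∷ [])            = refl
∣swap∣ zero    (true  ∷ true  ∷ S) = refl
∣swap∣ zero    (true  ∷ false ∷ S) = refl
∣swap∣ zero    (false ∷ true  ∷ S) = refl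
∣swap∣ zero    (false ∷ false ∷ S) = refl
∣swap∣ (suc i) (true  ∷ S)         = cong suc (∣swap∣ i S)
∣swap∣ (suc i) (false ∷ S)         = ∣swap∣ i S

swap-△ : ∀ {n} i (S T : Subset n) → swap i S △ swap i T ≡ swap i (S △ T)
swap-△ _       []          []          = refl
swap-△ zero    (x ∷ [])    (y ∷ [])    = refl
swap-△ zero    (x ∷ _ ∷ S) (y ∷ _ ∷ T) = refl
swap-△ (suc i) (x ∷ S)     (y ∷ T)     = cong (_ ∷_) (swap-△ i S T)

-- Deletes the first member together with its position; this supplies the intermediate set in
-- `swap-connected`.
removeOne : ∀ {n m} (S : Subset (suc n)) → ∣ S ∣ ≡ suc m → ∃ λ (T : Subset n) → ∣ T ∣ ≡ m
removeOne         (true  ∷ S)     e = S , ℕ.suc-injective e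
removeOne {suc n} (false ∷ S)     e = let T , e′ = removeOne S e in false ∷ T , e′
removeOne {zero}  (false ∷ [])    ()

-- Adjacent transpositions act transitively on sets of equal size. Equal heads stay in place. If the
-- heads differ, the tail is first rearranged so that its own head is the one wanted in front, the
-- swap at 0 exchanges the two, and the new tail is rearranged into the target.
swap-connected : ∀ {n} (P : Subset n → Set) → (∀ i S → P S → P (swap i S)) →
                 ∀ S T → ∣ S ∣ ≡ ∣ T ∣ → P S → P T
swap-connected P step []          []          e p = p
swap-connected P step (true ∷ S)  (true ∷ T)  e p =
  swap-connected (P ∘ (true ∷_)) (λ i S → step (suc i) (true ∷ S)) S T (ℕ.suc-injective e) p
swap-connected P step (false ∷ S) (false ∷ T) e p =
  swap-connected (P ∘ (false ∷_)) (λ i S → step (suc i) (false ∷ S)) S T e p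
swap-connected {suc (suc n)} P step (true ∷ S) (false ∷ T) e p =
  let U , ∣U∣ = removeOne T (sym e) in
  swap-connected (P ∘ (false ∷_)) (λ i S → step (suc i) (false ∷ S)) (true ∷ U) T (trans (cong suc ∣U∣) e)
    (step 0 (true ∷ false ∷ U)
      (swap-connected (P ∘ (true ∷_)) (λ i S → step (suc i) (true ∷ S)) S (false ∷ U) (sym ∣U∣) p))
swap-connected {suc (suc n)} P step (false ∷ S) (true ∷ T) e p =
  let U , ∣U∣ = removeOne S e in
  swap-connected (P ∘ (true ∷_)) (λ i S → step (suc i) (true ∷ S)) (false ∷ U) T ∣U∣
    (step 0 (false ∷ true ∷ U)
      (swap-connected (P ∘ (false ∷_)) (λ i S → step (suc i) (false ∷ S)) S (true ∷ U) (trans e (cong suc (sym ∣U∣))) p))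
swap-connected {suc zero} P step (true ∷ []) (false ∷ []) ()
swap-connected {suc zero} P step (false ∷ []) (true ∷ []) ()

-- Sums over all subsets and numbers of neighbours

bit : Bool → ℕ
bit b = if b then 1 else 0

∑ˢ : ∀ {n} → (Subset n → ℕ) → ℕ
∑ˢ {zero}  F = F []
∑ˢ {suc n} F = ∑ˢ (F ∘ (true ∷_)) ℕ.+ ∑ˢ (F ∘ (false ∷_))

∑ˢ-zero : ∀ n {F : Subset n → ℕ} → (∀ T → F T ≡ 0) → ∑ˢ F ≡ 0
∑ˢ-zero zero    e = e []
∑ˢ-zero (suc n) e = cong₂ ℕ._+_ (∑ˢ-zero n (e ∘ (true ∷_))) (∑ˢ-zero n (e ∘ (false ∷_)))

∑ˢ-cong : ∀ {n} {F G : Subset n → ℕ} → (∀ T → F T ≡ G T) → ∑ˢ F ≡ ∑ˢ G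
∑ˢ-cong {zero}  e = e []
∑ˢ-cong {suc n} e = cong₂ ℕ._+_ (∑ˢ-cong (e ∘ (true ∷_))) (∑ˢ-cong (e ∘ (false ∷_)))

∑ˢ-remove : ∀ {n} (F G : Subset n → ℕ) U → G U ≡ 0 → (∀ T → T ≢ U → G T ≡ F T) →
            ∑ˢ F ≡ F U ℕ.+ ∑ˢ G
∑ˢ-remove F G []          z e = sym (trans (cong (F [] ℕ.+_) z) (ℕ.+-identityʳ _))
∑ˢ-remove F G (true  ∷ U) z e = trans
  (cong₂ ℕ._+_
    (∑ˢ-remove (F ∘ (true ∷_)) (G ∘ (true ∷_)) U z λ T T≢U → e (true ∷ T) (T≢U ∘ ∷-injectiveʳ))
    (sym (∑ˢ-cong λ T → e (false ∷ T) λ ())))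
  (ℕ.+-assoc (F (true ∷ U)) _ _)
∑ˢ-remove F G (false ∷ U) z e = trans
  (cong₂ ℕ._+_
    (sym (∑ˢ-cong λ T → e (true ∷ T) λ ()))
    (∑ˢ-remove (F ∘ (false ∷_)) (G ∘ (false ∷_)) U z λ T T≢U → e (false ∷ T) (T≢U ∘ ∷-injectiveʳ)))
  (x∙yz≈y∙xz (∑ˢ (G ∘ (true ∷_))) (F (false ∷ U)) _)

-- Split off the term at `f zero` and replace `F` by `G`, which is zero there. By injectivity the
-- remaining terms avoid that set, so they are the same for `F` and `G`.
sum-injective : ∀ {N n} (f : Fin N → Subset n) → Injective _≡_ _≡_ f → (F : Subset n → ℕ) →
                ℕ∑.sum (F ∘ f) ℕ.≤ ∑ˢ F
sum-injective {zero}  f inj F = ℕ.z≤n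
sum-injective {suc N} f inj F = begin
  F (f zero) ℕ.+ ℕ∑.sum (F ∘ f ∘ suc)
    ≡⟨ cong (F (f zero) ℕ.+_) (ℕ∑.sum-cong-≗ λ i → sym (agree (f (suc i)) λ e → case inj e of λ ())) ⟩
  F (f zero) ℕ.+ ℕ∑.sum (G ∘ f ∘ suc)
    ≤⟨ ℕ.+-monoʳ-≤ (F (f zero)) (sum-injective (f ∘ suc) (Fin.suc-injective ∘ inj) G) ⟩
  F (f zero) ℕ.+ ∑ˢ G
    ≡⟨ sym (∑ˢ-remove F G (f zero) vanish agree) ⟩
  ∑ˢ F ∎
  where
  open ℕ.≤-Reasoning
  G : Subset _ → ℕ
  G T = if does (≡-dec Bool._≟_ T (f zero)) then 0 else F T
  vanish : G (f zero) ≡ 0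
  vanish = cong (if_then 0 else F (f zero)) (dec-true (≡-dec Bool._≟_ (f zero) (f zero)) refl)
  agree : ∀ T → T ≢ f zero → G T ≡ F T
  agree T T≢ = cong (if_then 0 else F T) (dec-false (≡-dec Bool._≟_ T (f zero)) T≢)

-- `α` counts the elements of `T` outside `S`, and `β` those of `S` outside `T`. Both budgets are
-- spent position by position, so that `∑ˢ` over `T` unfolds along with the recursion.
differBy : ∀ {n} → Subset n → Subset n → ℕ → ℕ → Bool
differBy []          []          zero    zero    = true
differBy []          []          _       _       = false
differBy (true  ∷ S) (true  ∷ T) α       β       = differBy S T α β
differBy (false ∷ S) (false ∷ T) α       β       = differBy S T α β
differBy (false ∷ S) (true  ∷ T) zero    β       = false
differBy (false ∷ S) (true  ∷ T) (suc α) β       = differBy S T α β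
differBy (true  ∷ S) (false ∷ T) α       zero    = false
differBy (true  ∷ S) (false ∷ T) α       (suc β) = differBy S T α β

differBy-─ : ∀ {n} (S T : Subset n) → differBy S T ∣ T ─ S ∣ ∣ S ─ T ∣ ≡ true
differBy-─ []          []          = refl
differBy-─ (true  ∷ S) (true  ∷ T) = differBy-─ S T
differBy-─ (true  ∷ S) (false ∷ T) = differBy-─ S T
differBy-─ (false ∷ S) (true  ∷ T) = differBy-─ S T
differBy-─ (false ∷ S) (false ∷ T) = differBy-─ S T

∣△∣ : ∀ {n} (S T : Subset n) → ∣ S △ T ∣ ≡ ∣ S ─ T ∣ ℕ.+ ∣ T ─ S ∣
∣△∣ []          []          = refl
∣△∣ (true  ∷ S) (true  ∷ T) = ∣△∣ S T
∣△∣ (true  ∷ S) (false ∷ T) = cong suc (∣△∣ S T)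
∣△∣ (false ∷ S) (true  ∷ T) = trans (cong suc (∣△∣ S T)) (sym (ℕ.+-suc ∣ S ─ T ∣ ∣ T ─ S ∣))
∣△∣ (false ∷ S) (false ∷ T) = ∣△∣ S T

∣T∣+∣S─T∣ : ∀ {n} (S T : Subset n) → ∣ T ∣ ℕ.+ ∣ S ─ T ∣ ≡ ∣ S ∣ ℕ.+ ∣ T ─ S ∣
∣T∣+∣S─T∣ []          []          = refl
∣T∣+∣S─T∣ (true  ∷ S) (true  ∷ T) = cong suc (∣T∣+∣S─T∣ S T)
∣T∣+∣S─T∣ (true  ∷ S) (false ∷ T) = trans (ℕ.+-suc ∣ T ∣ _) (cong suc (∣T∣+∣S─T∣ S T))
∣T∣+∣S─T∣ (false ∷ S) (true  ∷ T) = trans (cong suc (∣T∣+∣S─T∣ S T)) (sym (ℕ.+-suc ∣ S ∣ _))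
∣T∣+∣S─T∣ (false ∷ S) (false ∷ T) = ∣T∣+∣S─T∣ S T

-- Equal sizes make the two one-sided differences equally large, and together they have 2j elements.
adjacent⇒differBy : ∀ {n j} (S T : Subset n) → ∣ S ∣ ≡ ∣ T ∣ → ∣ S △ T ∣ ≡ 2 ℕ.* j →
                    differBy S T j j ≡ true
adjacent⇒differBy {j = j} S T eq adj =
  subst₂ (λ α β → differBy S T α β ≡ true) (trans (sym same) half) half (differBy-─ S T)
  where
  same : ∣ S ─ T ∣ ≡ ∣ T ─ S ∣
  same = ℕ.+-cancelˡ-≡ ∣ T ∣ _ _
    (trans (∣T∣+∣S─T∣ S T) (cong (ℕ._+ ∣ T ─ S ∣) eq))
  half : ∣ S ─ T ∣ ≡ j
  half = ℕ.*-cancelˡ-≡ ∣ S ─ T ∣ j 2 (trans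
    (cong (∣ S ─ T ∣ ℕ.+_) (trans (ℕ.+-identityʳ _) same))
    (trans (sym (∣△∣ S T)) adj))

-- h (β - 1), read as 0 at β = 0.
shift : (ℕ → ℕ) → ℕ → ℕ
shift h zero    = 0
shift h (suc β) = h β

pascal : ∀ k β → suc k C β ≡ k C β ℕ.+ shift (k C_) β
pascal k zero    = refl
pascal k (suc β) = trans (sym (nCk+nC[k+1]≡[n+1]C[k+1] k β)) (ℕ.+-comm (k C β) _)

pascal′ : ∀ k β → shift (suc k C_) β ≡ shift (k C_) β ℕ.+ shift (shift (k C_)) β
pascal′ k zero    = refl
pascal′ k (suc β) = pascal k β

outs : ∀ {n} → Subset n → ℕ
outs []          = 0
outs (true  ∷ S) = outs S
outs (false ∷ S) = suc (outs S)

outs+∣∣ : ∀ {n} (S : Subset n) → outs S ℕ.+ ∣ S ∣ ≡ n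
outs+∣∣ []          = refl
outs+∣∣ (true  ∷ S) = trans (ℕ.+-suc (outs S) _) (cong suc (outs+∣∣ S))
outs+∣∣ (false ∷ S) = cong suc (outs+∣∣ S)

-- `T` arises by adding α of the absent elements and removing β of the present ones. Each position
-- of `S` is one use of Pascal's rule in the corresponding factor.
count-differBy : ∀ {n} (S : Subset n) α β →
  ∑ˢ (λ T → bit (differBy S T α β)) ≡ (outs S C α) ℕ.* (∣ S ∣ C β)
count-differBy []          zero    zero    = refl
count-differBy []          zero    (suc β) = refl
count-differBy []          (suc α) β       = refl
count-differBy {suc n} (true ∷ S)  α       zero    =
  trans (cong₂ ℕ._+_ (count-differBy S α 0) (∑ˢ-zero n λ _ → refl)) (ℕ.+-identityʳ _)
count-differBy (true ∷ S)  α       (suc β) =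
  trans (cong₂ ℕ._+_ (count-differBy S α (suc β)) (count-differBy S α β))
    (trans (sym (ℕ.*-distribˡ-+ (outs S C α) _ _)) (cong ((outs S C α) ℕ.*_) (sym (pascal ∣ S ∣ (suc β)))))
count-differBy {suc n} (false ∷ S) zero    β       =
  cong₂ ℕ._+_ (∑ˢ-zero n λ _ → refl) (count-differBy S 0 β)
count-differBy (false ∷ S) (suc α) β       =
  trans (cong₂ ℕ._+_ (count-differBy S α β) (count-differBy S (suc α) β))
    (trans (sym (ℕ.*-distribʳ-+ (∣ S ∣ C β) (outs S C α) _))
      (cong (ℕ._* (∣ S ∣ C β)) (nCk+nC[k+1]≡[n+1]C[k+1] (outs S) α)))

-- This and `outsBut` count the members and non-members of `S` off the pair `i`, `i + 1`: the
-- positions still free once the behaviour on the pair is fixed.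
insBut : ∀ {n} → ℕ → Subset n → ℕ
insBut _       []          = 0
insBut zero    (x ∷ [])    = 0
insBut zero    (x ∷ y ∷ S) = ∣ S ∣
insBut (suc i) (x ∷ S)     = bit x ℕ.+ insBut i S

outsBut : ∀ {n} → ℕ → Subset n → ℕ
outsBut _       []          = 0
outsBut zero    (x ∷ [])    = 0
outsBut zero    (x ∷ y ∷ S) = outs S
outsBut (suc i) (true  ∷ S) = outsBut i S
outsBut (suc i) (false ∷ S) = suc (outsBut i S)

separates⇒∣∣ : ∀ {n} i (S : Subset n) → separates i S ≡ true → ∣ S ∣ ≡ suc (insBut i S)
separates⇒∣∣ zero    (true  ∷ false ∷ S) _ = refl
separates⇒∣∣ zero    (false ∷ true  ∷ S) _ = refl
separates⇒∣∣ (suc i) (true  ∷ S)         e = cong suc (separates⇒∣∣ i S e)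
separates⇒∣∣ (suc i) (false ∷ S)         e = separates⇒∣∣ i S e

separates⇒outs : ∀ {n} i (S : Subset n) → separates i S ≡ true → outs S ≡ suc (outsBut i S)
separates⇒outs zero    (true  ∷ false ∷ S) _ = refl
separates⇒outs zero    (false ∷ true  ∷ S) _ = refl
separates⇒outs (suc i) (true  ∷ S)         e = separates⇒outs i S e
separates⇒outs (suc i) (false ∷ S)         e = cong suc (separates⇒outs i S e)

-- Both sets meet the pair in one point. If it is the same point, all changes take place off the
-- pair; otherwise one addition and one removal are spent on the pair, which lowers both lower
-- indices by one. Positions before the pair contribute Pascal steps as in `count-differBy`.
count-separating : ∀ {n} i (S : Subset n) α β → separates i S ≡ true →
  ∑ˢ (λ T → bit (separates i T ∧ differBy S T α β)) ≡
  (outsBut i S C α) ℕ.* (insBut i S C β) ℕ.+ shift (outsBut i S C_) α ℕ.* shift (insBut i S C_) β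
count-separating {suc (suc n)} zero (true ∷ false ∷ S) α β _ = trans
  -- Of the four ways `T` can meet the pair, the first and last do not separate it, the second
  -- agrees with `S`, and the third exchanges the two points.
  (cong₂ ℕ._+_
    (cong₂ ℕ._+_ (∑ˢ-zero n λ _ → refl) (count-differBy S α β))
    (cong₂ ℕ._+_ (flipped α β) (∑ˢ-zero n λ _ → refl)))
  (cong ((outs S C α) ℕ.* (∣ S ∣ C β) ℕ.+_) (ℕ.+-identityʳ _))
  where
  flipped : ∀ α β → ∑ˢ (λ T → bit (differBy (true ∷ false ∷ S) (false ∷ true ∷ T) α β)) ≡
            shift (outs S C_) α ℕ.* shift (∣ S ∣ C_) β
  flipped zero    zero    = ∑ˢ-zero n λ _ → refl
  flipped zero    (suc β) = ∑ˢ-zero n λ _ → refl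
  flipped (suc α) zero    = trans (∑ˢ-zero n λ _ → refl) (sym (ℕ.*-zeroʳ (outs S C α)))
  flipped (suc α) (suc β) = count-differBy S α β
count-separating {suc (suc n)} zero (false ∷ true ∷ S) α β _ = trans
  (cong₂ ℕ._+_
    (cong₂ ℕ._+_ (∑ˢ-zero n λ _ → refl) (flipped α β))
    (cong₂ ℕ._+_ (count-differBy S α β) (∑ˢ-zero n λ _ → refl)))
  (trans (cong (shift (outs S C_) α ℕ.* shift (∣ S ∣ C_) β ℕ.+_) (ℕ.+-identityʳ _))
    (ℕ.+-comm (shift (outs S C_) α ℕ.* _) _))
  where
  flipped : ∀ α β → ∑ˢ (λ T → bit (differBy (false ∷ true ∷ S) (true ∷ false ∷ T) α β)) ≡
            shift (outs S C_) α ℕ.* shift (∣ S ∣ C_) β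
  flipped zero    β       = ∑ˢ-zero n λ _ → refl
  flipped (suc α) zero    = trans (∑ˢ-zero n λ _ → refl) (sym (ℕ.*-zeroʳ (outs S C α)))
  flipped (suc α) (suc β) = count-differBy S α β
count-separating {suc n} (suc i) (true ∷ S) α β sep = trans
  (cong₂ ℕ._+_ (count-separating i S α β sep) (rest β))
  (trans
    (solve 6 (λ a b b′ c d d′ → (a :* b :+ c :* d) :+ (a :* b′ :+ c :* d′) :=
                                a :* (b :+ b′) :+ c :* (d :+ d′)) refl
      (outsBut i S C α) (insBut i S C β) (shift (insBut i S C_) β)
      (shift (outsBut i S C_) α) (shift (insBut i S C_) β) (shift (shift (insBut i S C_)) β))
    (sym (cong₂ (λ p q → (outsBut i S C α) ℕ.* p ℕ.+ shift (outsBut i S C_) α ℕ.* q)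
      (pascal (insBut i S) β) (pascal′ (insBut i S) β))))
  where
  open ℕ-Solver using (solve; _:=_; _:+_; _:*_)
  -- Here `T` lacks an element of `S`, which uses up one removal: no such `T` for β = 0, and the
  -- induction hypothesis for β - 1 otherwise.
  rest : ∀ β → ∑ˢ (λ T → bit (separates i T ∧ differBy (true ∷ S) (false ∷ T) α β)) ≡
         (outsBut i S C α) ℕ.* shift (insBut i S C_) β ℕ.+
         shift (outsBut i S C_) α ℕ.* shift (shift (insBut i S C_)) β
  rest zero    = trans (∑ˢ-zero n λ T → cong bit (∧-zeroʳ (separates i T)))
    (sym (cong₂ ℕ._+_ (ℕ.*-zeroʳ (outsBut i S C α)) (ℕ.*-zeroʳ (shift (outsBut i S C_) α))))
  rest (suc β) = count-separating i S α β sep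
count-separating {suc n} (suc i) (false ∷ S) α β sep = trans
  (cong₂ ℕ._+_ (rest α) (count-separating i S α β sep))
  (trans
    (solve 6 (λ a a′ b c c′ d → (a′ :* b :+ c′ :* d) :+ (a :* b :+ c :* d) :=
                                (a :+ a′) :* b :+ (c :+ c′) :* d) refl
      (outsBut i S C α) (shift (outsBut i S C_) α) (insBut i S C β)
      (shift (outsBut i S C_) α) (shift (shift (outsBut i S C_)) α) (shift (insBut i S C_) β))
    (sym (cong₂ (λ p q → p ℕ.* (insBut i S C β) ℕ.+ q ℕ.* shift (insBut i S C_) β)
      (pascal (outsBut i S) α) (pascal′ (outsBut i S) α))))
  where
  open ℕ-Solver using (solve; _:=_; _:+_; _:*_)
  rest : ∀ α → ∑ˢ (λ T → bit (separates i T ∧ differBy (false ∷ S) (true ∷ T) α β)) ≡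
         shift (outsBut i S C_) α ℕ.* (insBut i S C β) ℕ.+
         shift (shift (outsBut i S C_)) α ℕ.* shift (insBut i S C_) β
  rest zero    = ∑ˢ-zero n λ T → cong bit (∧-zeroʳ (separates i T))
  rest (suc α) = count-separating i S α β sep

-- Binomial identities and the share of separating neighbours

absorption : ∀ n k → suc k ℕ.* (suc n C suc k) ≡ suc n ℕ.* (n C k)
absorption n       zero    = trans (ℕ.*-identityˡ _) (trans (nC1≡n (suc n)) (sym (ℕ.*-identityʳ _)))
absorption zero    (suc k) = trans
  (cong (suc (suc k) ℕ.*_) (sym (nCk+nC[k+1]≡[n+1]C[k+1] 0 (suc k))))
  (ℕ.*-zeroʳ (suc (suc k)))
absorption (suc n) (suc k) = begin
  (2 ℕ.+ k) ℕ.* (suc (suc n) C suc (suc k))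
    ≡⟨ cong ((2 ℕ.+ k) ℕ.*_) (sym (nCk+nC[k+1]≡[n+1]C[k+1] (suc n) (suc k))) ⟩
  (2 ℕ.+ k) ℕ.* (b ℕ.+ c)
    ≡⟨ solve 3 (λ k b c → (con 2 :+ k) :* (b :+ c) := b :+ ((con 1 :+ k) :* b :+ (con 2 :+ k) :* c)) refl k b c ⟩
  b ℕ.+ (suc k ℕ.* b ℕ.+ (2 ℕ.+ k) ℕ.* c)
    ≡⟨ cong (b ℕ.+_) (cong₂ ℕ._+_ (absorption n k) (absorption n (suc k))) ⟩
  b ℕ.+ (suc n ℕ.* (n C k) ℕ.+ suc n ℕ.* (n C suc k))
    ≡⟨ cong (b ℕ.+_) (sym (ℕ.*-distribˡ-+ (suc n) (n C k) _)) ⟩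
  b ℕ.+ suc n ℕ.* ((n C k) ℕ.+ (n C suc k))
    ≡⟨ cong (λ z → b ℕ.+ suc n ℕ.* z) (nCk+nC[k+1]≡[n+1]C[k+1] n k) ⟩
  (2 ℕ.+ n) ℕ.* (suc n C suc k) ∎
  where
  open ≡-Reasoning
  open ℕ-Solver using (solve; _:=_; _:+_; _:*_; con)
  b c : ℕ
  b = suc n C suc k
  c = suc n C suc (suc k)

-- The number of separating neighbours in J(2k + 2, k + 1, j). The parameter is one less than the
-- size of a vertex, because the pair takes away one member and one non-member.
separatingDegree : ℕ → ℕ → ℕ
separatingDegree k j = (k C j) ℕ.* (k C j) ℕ.+ shift (k C_) j ℕ.* shift (k C_) j

-- This is m / d ≤ 1 - j / K for K = k + 1, with denominators cleared. For positive j let J be its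
-- value and r = K - J. Then K a = r c and K b = J c, so after one more factor K both sides are
-- multiples of c², and what remains is r² + J² + K J ≤ K², that is, J ≤ r.
separatingDegree-bound : ∀ k j → 2 ℕ.* j ℕ.≤ suc k →
  suc k ℕ.* separatingDegree k j ℕ.+ j ℕ.* degree (suc k) j ℕ.≤ suc k ℕ.* degree (suc k) j
separatingDegree-bound k zero _ = ℕ.≤-reflexive (ℕ.+-identityʳ _)
separatingDegree-bound k (suc j) le = ℕ.*-cancelˡ-≤ (suc k) (begin
  suc k ℕ.* (suc k ℕ.* (a ℕ.* a ℕ.+ b ℕ.* b) ℕ.+ suc j ℕ.* (c ℕ.* (c ℕ.* 1)))
    ≡⟨ solve 5 (λ K J a b c → K :* (K :* (a :* a :+ b :* b) :+ J :* (c :* (c :* con 1))) :=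
         (K :* a) :* (K :* a) :+ (K :* b) :* (K :* b) :+ K :* J :* (c :* c)) refl (suc k) (suc j) a b c ⟩
  (suc k ℕ.* a) ℕ.* (suc k ℕ.* a) ℕ.+ (suc k ℕ.* b) ℕ.* (suc k ℕ.* b) ℕ.+ suc k ℕ.* suc j ℕ.* (c ℕ.* c)
    ≡⟨ cong₂ (λ p q → p ℕ.* p ℕ.+ q ℕ.* q ℕ.+ suc k ℕ.* suc j ℕ.* (c ℕ.* c)) eqa (sym (absorption k j)) ⟩
  (r ℕ.* c) ℕ.* (r ℕ.* c) ℕ.+ (suc j ℕ.* c) ℕ.* (suc j ℕ.* c) ℕ.+ suc k ℕ.* suc j ℕ.* (c ℕ.* c)
    ≡⟨ cong (λ z → (r ℕ.* c) ℕ.* (r ℕ.* c) ℕ.+ (suc j ℕ.* c) ℕ.* (suc j ℕ.* c) ℕ.+ z ℕ.* suc j ℕ.* (c ℕ.* c)) k≡ ⟩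
  (r ℕ.* c) ℕ.* (r ℕ.* c) ℕ.+ (suc j ℕ.* c) ℕ.* (suc j ℕ.* c) ℕ.+ (suc j ℕ.+ r) ℕ.* suc j ℕ.* (c ℕ.* c)
    ≡⟨ solve 3 (λ r J c → (r :* c) :* (r :* c) :+ (J :* c) :* (J :* c) :+ (J :+ r) :* J :* (c :* c) :=
         (r :* r :+ (con 2 :* J) :* J :+ r :* J) :* (c :* c)) refl r (suc j) c ⟩
  (r ℕ.* r ℕ.+ (2 ℕ.* suc j) ℕ.* suc j ℕ.+ r ℕ.* suc j) ℕ.* (c ℕ.* c)
    -- Here 2J ≤ K = J + r enters, in the middle term.
    ≤⟨ ℕ.*-monoˡ-≤ (c ℕ.* c) (ℕ.+-monoˡ-≤ (r ℕ.* suc j) (ℕ.+-monoʳ-≤ (r ℕ.* r)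
         (ℕ.*-monoˡ-≤ (suc j) (ℕ.≤-trans le (ℕ.≤-reflexive k≡))))) ⟩
  (r ℕ.* r ℕ.+ (suc j ℕ.+ r) ℕ.* suc j ℕ.+ r ℕ.* suc j) ℕ.* (c ℕ.* c)
    ≡⟨ solve 3 (λ r J c → (r :* r :+ (J :+ r) :* J :+ r :* J) :* (c :* c) :=
         (J :+ r) :* ((J :+ r) :* (c :* (c :* con 1)))) refl r (suc j) c ⟩
  (suc j ℕ.+ r) ℕ.* ((suc j ℕ.+ r) ℕ.* (c ℕ.* (c ℕ.* 1)))
    ≡⟨ cong (λ z → z ℕ.* (z ℕ.* (c ℕ.* (c ℕ.* 1)))) (sym k≡) ⟩
  suc k ℕ.* (suc k ℕ.* degree (suc k) (suc j)) ∎)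
  where
  open ℕ.≤-Reasoning
  open ℕ-Solver using (solve; _:=_; _:+_; _:*_; con)
  a b c r : ℕ
  a = k C suc j
  b = k C j
  c = suc k C suc j
  r = suc k ℕ.∸ suc j
  k≡ : suc k ≡ suc j ℕ.+ r
  k≡ = sym (ℕ.m+[n∸m]≡n (ℕ.≤-trans (ℕ.m≤m+n (suc j) _) le))
  -- Absorption turns K b into J c, and Pascal's rule b + a = c then leaves K a = (K - J) c.
  eqa : suc k ℕ.* a ≡ r ℕ.* c
  eqa = ℕ.+-cancelˡ-≡ (suc j ℕ.* c) _ _ (≡.begin
    suc j ℕ.* c ℕ.+ suc k ℕ.* a ≡.≡⟨ cong (ℕ._+ suc k ℕ.* a) (absorption k j) ⟩
    suc k ℕ.* b ℕ.+ suc k ℕ.* a ≡.≡⟨ sym (ℕ.*-distribˡ-+ (suc k) b a) ⟩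
    suc k ℕ.* (b ℕ.+ a)         ≡.≡⟨ cong (suc k ℕ.*_) (nCk+nC[k+1]≡[n+1]C[k+1] k j) ⟩
    suc k ℕ.* c                 ≡.≡⟨ cong (ℕ._* c) k≡ ⟩
    (suc j ℕ.+ r) ℕ.* c         ≡.≡⟨ ℕ.*-distribʳ-+ c (suc j) r ⟩
    suc j ℕ.* c ℕ.+ r ℕ.* c     ≡.∎)
    where module ≡ = ≡-Reasoning

-- The maximum principle over ℚ

open Algebra.Properties.CommutativeMonoid.Sum ℚ.+-0-commutativeMonoid
  using (sum; sum-cong-≗; ∑-distrib-+; sum-permute)
open Algebra.Properties.Semiring.Sum (CommutativeRing.semiring ℚ.+-*-commutativeRing)
  using (*-distribˡ-sum; *-distribʳ-sum)
open ℚ-Solver using (solve; _:=_; _:+_; _:*_; :-_; _:-_; con)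

ι : ℕ → ℚ
ι n = + n ℚ./ 1

fromℚᵘ-homo-+ : ∀ p q → ℚ.fromℚᵘ (p ℚᵘ.+ q) ≡ ℚ.fromℚᵘ p ℚ.+ ℚ.fromℚᵘ q
fromℚᵘ-homo-+ p q = ℚ.toℚᵘ-injective (ℚᵘ.≃-trans (ℚ.toℚᵘ-fromℚᵘ (p ℚᵘ.+ q)) (ℚᵘ.≃-sym
  (ℚᵘ.≃-trans (ℚ.toℚᵘ-homo-+ (ℚ.fromℚᵘ p) (ℚ.fromℚᵘ q))
    (ℚᵘ.+-cong (ℚ.toℚᵘ-fromℚᵘ p) (ℚ.toℚᵘ-fromℚᵘ q)))))

fromℚᵘ-homo-* : ∀ p q → ℚ.fromℚᵘ (p ℚᵘ.* q) ≡ ℚ.fromℚᵘ p ℚ.* ℚ.fromℚᵘ q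
fromℚᵘ-homo-* p q = ℚ.toℚᵘ-injective (ℚᵘ.≃-trans (ℚ.toℚᵘ-fromℚᵘ (p ℚᵘ.* q)) (ℚᵘ.≃-sym
  (ℚᵘ.≃-trans (ℚ.toℚᵘ-homo-* (ℚ.fromℚᵘ p) (ℚ.fromℚᵘ q))
    (ℚᵘ.*-cong (ℚ.toℚᵘ-fromℚᵘ p) (ℚ.toℚᵘ-fromℚᵘ q)))))

ι-+ : ∀ a b → ι (a ℕ.+ b) ≡ ι a ℚ.+ ι b
ι-+ a b = trans
  (cong (ℚ._/ 1) (sym (cong₂ ℤ._+_ (ℤ.*-identityʳ (+ a)) (ℤ.*-identityʳ (+ b)))))
  (fromℚᵘ-homo-+ (ℚᵘ.mkℚᵘ (+ a) 0) (ℚᵘ.mkℚᵘ (+ b) 0))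

ι-* : ∀ a b → ι (a ℕ.* b) ≡ ι a ℚ.* ι b
ι-* a b = trans
  (cong (ℚ._/ 1) (ℤ.pos-* a b))
  (fromℚᵘ-homo-* (ℚᵘ.mkℚᵘ (+ a) 0) (ℚᵘ.mkℚᵘ (+ b) 0))

ι-mono-≤ : ∀ {a b} → a ℕ.≤ b → ι a ℚ.≤ ι b
ι-mono-≤ {a} {b} le = ℚ.toℚᵘ-cancel-≤ (ℚᵘ.≤-respˡ-≃ (ℚᵘ.≃-sym (ℚ.toℚᵘ-fromℚᵘ (ℚᵘ.mkℚᵘ (+ a) 0)))
  (ℚᵘ.≤-respʳ-≃ (ℚᵘ.≃-sym (ℚ.toℚᵘ-fromℚᵘ (ℚᵘ.mkℚᵘ (+ b) 0)))
    (ℚᵘ.*≤* (ℤ.*-monoʳ-≤-nonNeg (+ 1) (ℤ.+≤+ le)))))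

/-*-ι : ∀ a d .{{_ : NonZero d}} → (+ a ℚ./ d) ℚ.* ι d ≡ ι a
/-*-ι a (suc d) = trans
  (sym (fromℚᵘ-homo-* (ℚᵘ.mkℚᵘ (+ a) d) (ℚᵘ.mkℚᵘ (+ suc d) 0)))
  (ℚ.fromℚᵘ-cong {ℚᵘ.mkℚᵘ (+ a) d ℚᵘ.* ℚᵘ.mkℚᵘ (+ suc d) 0} {ℚᵘ.mkℚᵘ (+ a) 0}
    (ℚᵘ.*≡* (trans (ℤ.*-identityʳ _) (cong (λ e → + a ℤ.* + suc e) (sym (ℕ.*-identityʳ d))))))

/-pos : ∀ a d .{{_ : NonZero a}} .{{_ : NonZero d}} → 0ℚ ℚ.< + a ℚ./ d
/-pos a d = ℚ.positive⁻¹ (+ a ℚ./ d) {{ℚ.normalize-pos a d}}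

p≤∣p∣ : ∀ p → p ℚ.≤ ℚ.∣ p ∣
p≤∣p∣ p with ℚ.∣p∣≡p∨∣p∣≡-p p
... | inj₁ e = ℚ.≤-reflexive (sym e)
... | inj₂ e = ℚ.≤-trans p≤0 (ℚ.0≤∣p∣ p)
  where
  p≤0 : p ℚ.≤ 0ℚ
  p≤0 = subst (ℚ._≤ 0ℚ) (trans (cong ℚ.-_ e) (solve 1 (λ p → :- (:- p) := p) refl p))
    (ℚ.neg-antimono-≤ (ℚ.0≤∣p∣ p))

+-self-cancel-< : ∀ {p q} → p ℚ.+ p ℚ.< q ℚ.+ q → p ℚ.< q
+-self-cancel-< {p} {q} lt = ℚ.≰⇒> λ q≤p → ℚ.<-irrefl refl (ℚ.<-≤-trans lt (ℚ.+-mono-≤ q≤p q≤p))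

*-pos : ∀ {p q} → 0ℚ ℚ.< p → 0ℚ ℚ.< q → 0ℚ ℚ.< p ℚ.* q
*-pos {p} {q} 0<p 0<q = subst (ℚ._< p ℚ.* q) (ℚ.*-zeroʳ p) (ℚ.*-monoʳ-<-pos p {{ℚ.positive 0<p}} 0<q)

argmax : ∀ {N} (f : Fin N → ℚ) → Fin N → ∃ λ i → ∀ w → f w ℚ.≤ f i
argmax {N} f i₀ = E.argmax f i₀ (allFin N) , λ w → All.lookup (E.f[xs]≤f[argmax] i₀ (allFin N)) (∈-allFin w)
  where module E = Extrema (DecTotalOrder.totalOrder ℚ.≤-decTotalOrder)

sum-mono-≤ : ∀ {N} {f g : Fin N → ℚ} → (∀ i → f i ℚ.≤ g i) → sum f ℚ.≤ sum g
sum-mono-≤ {zero}  le = ℚ.≤-refl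
sum-mono-≤ {suc N} le = ℚ.+-mono-≤ (le zero) (sum-mono-≤ (λ i → le (suc i)))

∣sum∣≤ : ∀ {N} (f : Fin N → ℚ) → ℚ.∣ sum f ∣ ℚ.≤ sum (λ i → ℚ.∣ f i ∣)
∣sum∣≤ {zero}  f = ℚ.≤-refl
∣sum∣≤ {suc N} f = ℚ.≤-trans (ℚ.∣p+q∣≤∣p∣+∣q∣ (f zero) (sum (f ∘ suc)))
  (ℚ.+-monoʳ-≤ ℚ.∣ f zero ∣ (∣sum∣≤ (f ∘ suc)))

sum-ι : ∀ {N} (f : Fin N → ℕ) → sum (ι ∘ f) ≡ ι (ℕ∑.sum f)
sum-ι {zero}  f = refl
sum-ι {suc N} f = trans (cong (ι (f zero) ℚ.+_) (sum-ι (f ∘ suc))) (sym (ι-+ (f zero) _))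

𝟙 : Bool → ℚ
𝟙 b = if b then 1ℚ else 0ℚ

sum-0 : ∀ {N} (z : Fin N → ℚ) → sum (λ w → 0ℚ ℚ.* z w) ≡ 0ℚ
sum-0 z = trans (sym (*-distribˡ-sum 0ℚ z)) (ℚ.*-zeroˡ (sum z))

sum-δ : ∀ {N} (i : Fin N) (z : Fin N → ℚ) → sum (λ w → 𝟙 (does (i Fin.≟ w)) ℚ.* z w) ≡ z i
sum-δ zero    z = trans (cong₂ ℚ._+_ (ℚ.*-identityˡ (z zero)) (sum-0 (z ∘ suc))) (ℚ.+-identityʳ _)
sum-δ (suc i) z = trans (cong₂ ℚ._+_ (ℚ.*-zeroˡ (z zero)) (sum-δ i (z ∘ suc))) (ℚ.+-identityˡ _)

-- Here σ i = true where z i and z (π i) may differ, δ = 1 / d and q = η / 2.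
module MaximumPrinciple
  {N : ℕ} (K : Fin N → Fin N → Bool) (π : Permutation′ N)
  (K-π : ∀ i w → K (π ⟨$⟩ʳ i) (π ⟨$⟩ʳ w) ≡ K i w)
  (σ : Fin N → Bool) (fixed : ∀ i → σ i ≡ false → π ⟨$⟩ʳ i ≡ i)
  {δ q : ℚ} (0≤δ : 0ℚ ℚ.≤ δ) (0<q : 0ℚ ℚ.< q)
  (sparse : ∀ i → σ i ≡ true →
    δ ℚ.* ι (ℕ∑.sum λ w → bit (σ w ∧ K i w)) ℚ.≤ 1ℚ ℚ.- (q ℚ.+ q ℚ.+ (q ℚ.+ q)))
  (z : Fin N → ℚ) {τ ε : ℚ} (τ<2q : τ ℚ.< q ℚ.+ q)
  (residual : ∀ i → ℚ.∣ sum (λ w → (𝟙 (does (i Fin.≟ w)) ℚ.- δ ℚ.* 𝟙 (K i w)) ℚ.* z w) ℚ.- τ ℚ.* z i ∣ ℚ.< ε)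
  where

  private
    A : (Fin N → ℚ) → Fin N → ℚ
    A x i = sum λ w → 𝟙 (K i w) ℚ.* x w

    -- `r` is the error in the equation z - δ A z = τ z; `y` compares `z` with its image under `π`.
    r y : Fin N → ℚ
    r i = (z i ℚ.- δ ℚ.* A z i) ℚ.- τ ℚ.* z i
    y i = z i ℚ.- z (π ⟨$⟩ʳ i)

    laplacian : ∀ i → sum (λ w → (𝟙 (does (i Fin.≟ w)) ℚ.- δ ℚ.* 𝟙 (K i w)) ℚ.* z w) ≡
                z i ℚ.- δ ℚ.* A z i
    laplacian i = begin
      sum (λ w → (I w ℚ.- δ ℚ.* 𝟙 (K i w)) ℚ.* z w)
        ≡⟨ sum-cong-≗ (λ w → solve 4 (λ a d k z → (a :- d :* k) :* z := a :* z :+ (:- d) :* (k :* z)) refl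
             (I w) δ (𝟙 (K i w)) (z w)) ⟩
      sum (λ w → I w ℚ.* z w ℚ.+ (ℚ.- δ) ℚ.* (𝟙 (K i w) ℚ.* z w))
        ≡⟨ ∑-distrib-+ (λ w → I w ℚ.* z w) _ ⟩
      sum (λ w → I w ℚ.* z w) ℚ.+ sum (λ w → (ℚ.- δ) ℚ.* (𝟙 (K i w) ℚ.* z w))
        ≡⟨ cong₂ ℚ._+_ (sum-δ i z) (sym (*-distribˡ-sum (ℚ.- δ) (λ w → 𝟙 (K i w) ℚ.* z w))) ⟩
      z i ℚ.+ (ℚ.- δ) ℚ.* A z i
        ≡⟨ cong (z i ℚ.+_) (sym (ℚ.neg-distribˡ-* δ (A z i))) ⟩
      z i ℚ.- δ ℚ.* A z i ∎
      where
      open ≡-Reasoning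
      I : Fin N → ℚ
      I w = 𝟙 (does (i Fin.≟ w))

    ∣r∣<ε : ∀ i → ℚ.∣ r i ∣ ℚ.< ε
    ∣r∣<ε i = subst (λ s → ℚ.∣ s ℚ.- τ ℚ.* z i ∣ ℚ.< ε) (laplacian i) (residual i)

    -- Adjacency is invariant under `π`, so reindexing the sum at `π i` by `π` turns it into the sum
    -- at `i` for the permuted vector.
    A-y : ∀ i → A z i ℚ.- A z (π ⟨$⟩ʳ i) ≡ A y i
    A-y i = begin
      A z i ℚ.- A z (π ⟨$⟩ʳ i)
        ≡⟨ cong (λ s → A z i ℚ.- s) (sum-permute (λ w → 𝟙 (K (π ⟨$⟩ʳ i) w) ℚ.* z w) π) ⟩
      A z i ℚ.- sum (λ w → 𝟙 (K (π ⟨$⟩ʳ i) (π ⟨$⟩ʳ w)) ℚ.* z (π ⟨$⟩ʳ w))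
        ≡⟨ cong (λ s → A z i ℚ.- s) (sum-cong-≗ λ w → cong (λ b → 𝟙 b ℚ.* z (π ⟨$⟩ʳ w)) (K-π i w)) ⟩
      A z i ℚ.- A (λ w → z (π ⟨$⟩ʳ w)) i
        ≡⟨ solve 2 (λ a b → a :- b := a :+ (:- con 1ℚ) :* b) refl (A z i) _ ⟩
      A z i ℚ.+ (ℚ.- 1ℚ) ℚ.* A (λ w → z (π ⟨$⟩ʳ w)) i
        ≡⟨ cong (A z i ℚ.+_) (*-distribˡ-sum (ℚ.- 1ℚ) (λ w → 𝟙 (K i w) ℚ.* z (π ⟨$⟩ʳ w))) ⟩
      A z i ℚ.+ sum (λ w → (ℚ.- 1ℚ) ℚ.* (𝟙 (K i w) ℚ.* z (π ⟨$⟩ʳ w)))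
        ≡⟨ sym (∑-distrib-+ (λ w → 𝟙 (K i w) ℚ.* z w) _) ⟩
      sum (λ w → 𝟙 (K i w) ℚ.* z w ℚ.+ (ℚ.- 1ℚ) ℚ.* (𝟙 (K i w) ℚ.* z (π ⟨$⟩ʳ w)))
        ≡⟨ sum-cong-≗ (λ w → solve 3 (λ k a b → k :* a :+ (:- con 1ℚ) :* (k :* b) := k :* (a :- b)) refl
             (𝟙 (K i w)) (z w) (z (π ⟨$⟩ʳ w))) ⟩
      A y i ∎
      where open ≡-Reasoning

    y-fixed : ∀ i → σ i ≡ false → ℚ.∣ y i ∣ ≡ 0ℚ
    y-fixed i e = trans (cong (λ j → ℚ.∣ z i ℚ.- z j ∣) (fixed i e)) (cong ℚ.∣_∣ (ℚ.+-inverseʳ (z i)))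

    -- Where `σ w` is false, `π` fixes `w` and `y w` vanishes, so only the neighbours with `σ w`
    -- true contribute.
    ∣A-y∣≤ : ∀ M → (∀ w → ℚ.∣ y w ∣ ℚ.≤ M) → ∀ i →
             ℚ.∣ A y i ∣ ℚ.≤ ι (ℕ∑.sum λ w → bit (σ w ∧ K i w)) ℚ.* M
    ∣A-y∣≤ M y≤M i = begin
      ℚ.∣ A y i ∣
        ≤⟨ ∣sum∣≤ (λ w → 𝟙 (K i w) ℚ.* y w) ⟩
      sum (λ w → ℚ.∣ 𝟙 (K i w) ℚ.* y w ∣)
        ≤⟨ sum-mono-≤ term ⟩
      sum (λ w → ι (bit (σ w ∧ K i w)) ℚ.* M)
        ≡⟨ sym (*-distribʳ-sum M (λ w → ι (bit (σ w ∧ K i w)))) ⟩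
      sum (λ w → ι (bit (σ w ∧ K i w))) ℚ.* M
        ≡⟨ cong (ℚ._* M) (sum-ι (λ w → bit (σ w ∧ K i w))) ⟩
      ι (ℕ∑.sum λ w → bit (σ w ∧ K i w)) ℚ.* M ∎
      where
      open ℚ.≤-Reasoning
      term : ∀ w → ℚ.∣ 𝟙 (K i w) ℚ.* y w ∣ ℚ.≤ ι (bit (σ w ∧ K i w)) ℚ.* M
      term w with K i w | σ w in e
      ... | true  | true  = ℚ.≤-trans (ℚ.≤-reflexive (cong ℚ.∣_∣ (ℚ.*-identityˡ (y w))))
                              (ℚ.≤-trans (y≤M w) (ℚ.≤-reflexive (sym (ℚ.*-identityˡ M))))
      ... | true  | false = ℚ.≤-reflexive (trans (cong ℚ.∣_∣ (ℚ.*-identityˡ (y w)))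
                              (trans (y-fixed w e) (sym (ℚ.*-zeroˡ M))))
      ... | false | true  = ℚ.≤-reflexive (trans (cong ℚ.∣_∣ (ℚ.*-zeroˡ (y w))) (sym (ℚ.*-zeroˡ M)))
      ... | false | false = ℚ.≤-reflexive (trans (cong ℚ.∣_∣ (ℚ.*-zeroˡ (y w))) (sym (ℚ.*-zeroˡ M)))

    -- Subtracting the equations at `i` and `π i` gives (1 - τ) y i = (r i - r (π i)) + δ (A y) i.
    -- With M the maximum of |y|, the last term is at most (1 - 4q) M by `sparse`. Hence (4q - τ) M
    -- < 2ε, and τ < 2q leaves 2q M < 2ε. If `σ i` is false, M is zero.
    extremal : ∀ i → (∀ w → ℚ.∣ y w ∣ ℚ.≤ ℚ.∣ y i ∣) → q ℚ.* ℚ.∣ y i ∣ ℚ.< ε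
    extremal i y≤M with σ i in e
    ... | false = subst (ℚ._< ε) (sym (trans (cong (q ℚ.*_) (y-fixed i e)) (ℚ.*-zeroʳ q)))
                    (ℚ.≤-<-trans (ℚ.0≤∣p∣ (r i)) (∣r∣<ε i))
    ... | true  = +-self-cancel-< (begin-strict
      q ℚ.* M ℚ.+ q ℚ.* M
        ≡⟨ solve 3 (λ q t M → q :* M :+ q :* M := (con 1ℚ :- t) :* M :+ (t :- (con 1ℚ :- (q :+ q))) :* M) refl q τ M ⟩
      (1ℚ ℚ.- τ) ℚ.* M ℚ.+ c ℚ.* M
        <⟨ ℚ.+-monoˡ-< (c ℚ.* M) step ⟩
      (ε ℚ.+ ε ℚ.+ δ ℚ.* (ι s ℚ.* M)) ℚ.+ c ℚ.* M
        ≡⟨ cong (λ x → ε ℚ.+ ε ℚ.+ x ℚ.+ c ℚ.* M) (sym (ℚ.*-assoc δ (ι s) M)) ⟩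
      (ε ℚ.+ ε ℚ.+ δ ℚ.* ι s ℚ.* M) ℚ.+ c ℚ.* M
        ≤⟨ ℚ.+-monoˡ-≤ (c ℚ.* M) (ℚ.+-monoʳ-≤ (ε ℚ.+ ε) (ℚ.*-monoʳ-≤-nonNeg M (sparse i e))) ⟩
      (ε ℚ.+ ε ℚ.+ (1ℚ ℚ.- (q ℚ.+ q ℚ.+ (q ℚ.+ q))) ℚ.* M) ℚ.+ c ℚ.* M
        ≡⟨ solve 4 (λ q t M ε → (ε :+ ε :+ (con 1ℚ :- (q :+ q :+ (q :+ q))) :* M) :+ (t :- (con 1ℚ :- (q :+ q))) :* M
             := ε :+ ε :+ (:- (q :+ q) :* M :+ t :* M)) refl q τ M ε ⟩
      ε ℚ.+ ε ℚ.+ ((ℚ.- (q ℚ.+ q)) ℚ.* M ℚ.+ τ ℚ.* M)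
        ≤⟨ ℚ.+-monoʳ-≤ (ε ℚ.+ ε) (ℚ.+-monoʳ-≤ ((ℚ.- (q ℚ.+ q)) ℚ.* M) (ℚ.*-monoʳ-≤-nonNeg M (ℚ.<⇒≤ τ<2q))) ⟩
      ε ℚ.+ ε ℚ.+ ((ℚ.- (q ℚ.+ q)) ℚ.* M ℚ.+ (q ℚ.+ q) ℚ.* M)
        ≡⟨ solve 3 (λ q M ε → ε :+ ε :+ (:- (q :+ q) :* M :+ (q :+ q) :* M) := ε :+ ε) refl q M ε ⟩
      ε ℚ.+ ε ∎)
      where
      open ℚ.≤-Reasoning
      M c : ℚ
      M = ℚ.∣ y i ∣
      -- Chosen so that 1 - τ + c = 2q; adding c M to both sides collects the terms in M whatever
      -- the sign of c.
      c = τ ℚ.- (1ℚ ℚ.- (q ℚ.+ q))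
      s : ℕ
      s = ℕ∑.sum λ w → bit (σ w ∧ K i w)
      instance
        M-nonNeg : ℚ.NonNegative M
        M-nonNeg = ℚ.∣-∣-nonNeg (y i)
        δ-nonNeg : ℚ.NonNegative δ
        δ-nonNeg = ℚ.nonNegative 0≤δ
      step : (1ℚ ℚ.- τ) ℚ.* M ℚ.< ε ℚ.+ ε ℚ.+ δ ℚ.* (ι s ℚ.* M)
      step = begin-strict
        (1ℚ ℚ.- τ) ℚ.* M
          ≤⟨ ℚ.*-monoʳ-≤-nonNeg M (p≤∣p∣ (1ℚ ℚ.- τ)) ⟩
        ℚ.∣ 1ℚ ℚ.- τ ∣ ℚ.* M
          ≡⟨ sym (ℚ.∣p*q∣≡∣p∣*∣q∣ (1ℚ ℚ.- τ) (y i)) ⟩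
        ℚ.∣ (1ℚ ℚ.- τ) ℚ.* y i ∣
          ≡⟨ cong ℚ.∣_∣ (solve 6 (λ t d z z′ a a′ → (con 1ℚ :- t) :* (z :- z′) :=
               (((z :- d :* a) :- t :* z) :- ((z′ :- d :* a′) :- t :* z′)) :+ d :* (a :- a′)) refl
               τ δ (z i) (z (π ⟨$⟩ʳ i)) (A z i) (A z (π ⟨$⟩ʳ i))) ⟩
        ℚ.∣ (r i ℚ.- r (π ⟨$⟩ʳ i)) ℚ.+ δ ℚ.* (A z i ℚ.- A z (π ⟨$⟩ʳ i)) ∣
          ≡⟨ cong (λ x → ℚ.∣ (r i ℚ.- r (π ⟨$⟩ʳ i)) ℚ.+ δ ℚ.* x ∣) (A-y i) ⟩
        ℚ.∣ (r i ℚ.- r (π ⟨$⟩ʳ i)) ℚ.+ δ ℚ.* A y i ∣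
          ≤⟨ ℚ.∣p+q∣≤∣p∣+∣q∣ (r i ℚ.- r (π ⟨$⟩ʳ i)) (δ ℚ.* A y i) ⟩
        ℚ.∣ r i ℚ.- r (π ⟨$⟩ʳ i) ∣ ℚ.+ ℚ.∣ δ ℚ.* A y i ∣
          <⟨ ℚ.+-mono-<-≤ small (ℚ.≤-reflexive (trans (ℚ.∣p*q∣≡∣p∣*∣q∣ δ (A y i))
               (cong (ℚ._* ℚ.∣ A y i ∣) (ℚ.0≤p⇒∣p∣≡p 0≤δ)))) ⟩
        ε ℚ.+ ε ℚ.+ δ ℚ.* ℚ.∣ A y i ∣
          ≤⟨ ℚ.+-monoʳ-≤ (ε ℚ.+ ε) (ℚ.*-monoˡ-≤-nonNeg δ (∣A-y∣≤ M y≤M i)) ⟩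
        ε ℚ.+ ε ℚ.+ δ ℚ.* (ι s ℚ.* M) ∎
        where
        small : ℚ.∣ r i ℚ.- r (π ⟨$⟩ʳ i) ∣ ℚ.< ε ℚ.+ ε
        small = ℚ.≤-<-trans (ℚ.∣p-q∣≤∣p∣+∣q∣ (r i) (r (π ⟨$⟩ʳ i)))
          (ℚ.+-mono-< (∣r∣<ε i) (∣r∣<ε (π ⟨$⟩ʳ i)))

  nearly-invariant : ∀ v → q ℚ.* ℚ.∣ z v ℚ.- z (π ⟨$⟩ʳ v) ∣ ℚ.< ε
  nearly-invariant v =
    let i , y≤yi = argmax (λ w → ℚ.∣ y w ∣) v
    in ℚ.≤-<-trans (ℚ.*-monoˡ-≤-nonNeg q {{ℚ.nonNegative (ℚ.<⇒≤ 0<q)}} (y≤yi v)) (extremal i y≤yi)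

-- Real numbers: order, cancellation, and passage to rational approximations

open CommutativeRing ℝ-commutativeRing using ()
  renaming (refl to ≈-refl; sym to ≈-sym; trans to ≈-trans)
open Coefficients ℝ-commutativeRing

eventually-× : ∀ {P Q : ℕ → Set} → Eventually P → Eventually Q → Eventually λ n → P n × Q n
eventually-× (M , p) (N , q) = M ℕ.⊔ N , λ n le →
  p n (ℕ.≤-trans (ℕ.m≤m⊔n M N) le) , q n (ℕ.≤-trans (ℕ.m≤n⊔m M N) le)

eventually-∀ : ∀ {N} {P : Fin N → ℕ → Set} → (∀ i → Eventually (P i)) → Eventually λ n → ∀ i → P i n
eventually-∀ {zero}  p = 0 , λ _ _ ()
eventually-∀ {suc N} p =
  let M , q = eventually-× (p zero) (eventually-∀ (p ∘ suc))
  in M , λ n le → λ { zero → proj₁ (q n le) ; (suc i) → proj₂ (q n le) i }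

∣x-y∣<ε⇒x<y+ε : ∀ x y {ε} → ℚ.∣ x ℚ.- y ∣ ℚ.< ε → x ℚ.< y ℚ.+ ε
∣x-y∣<ε⇒x<y+ε x y {ε} lt = subst (ℚ._< y ℚ.+ ε)
  (solve 2 (λ x y → y :+ (x :- y) := x) refl x y)
  (ℚ.+-monoʳ-< y (ℚ.≤-<-trans (p≤∣p∣ (x ℚ.- y)) lt))

-- A Cauchy sequence can be compared with a up to an error, which decides
-- between the conclusion and the premise being refuted.
fromℚ-≤ᴿ-stable : ∀ a y → ¬ Eventually (λ n → seq y n ℚ.< a) → fromℚ a ≤ᴿ y
fromℚ-≤ᴿ-stable a y ¬y<a ε 0<ε
  with cauchy y (½ ℚ.* ε) (*-pos (/-pos 1 2) 0<ε)
... | N , close with a ℚ.<? seq y N ℚ.+ ½ ℚ.* ε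
... | yes lt = N , λ n le → ℚ.<-trans lt (subst (seq y N ℚ.+ ½ ℚ.* ε ℚ.<_)
        (trans (ℚ.+-assoc (seq y n) (½ ℚ.* ε) (½ ℚ.* ε))
          (cong (seq y n ℚ.+_) (trans (sym (ℚ.*-distribʳ-+ ε ½ ½)) (ℚ.*-identityˡ ε))))
        (ℚ.+-monoˡ-< (½ ℚ.* ε) (∣x-y∣<ε⇒x<y+ε (seq y N) (seq y n) (close N n ℕ.≤-refl le))))
... | no ≮ = contradiction (N , λ n le →
        ℚ.<-≤-trans (∣x-y∣<ε⇒x<y+ε (seq y n) (seq y N) (close n N le ℕ.≤-refl)) (ℚ.≮⇒≥ ≮)) ¬y<a

∣x-0∣ : ∀ x → ℚ.∣ x ℚ.- 0ℚ ∣ ≡ ℚ.∣ x ∣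
∣x-0∣ x = cong ℚ.∣_∣ (ℚ.+-identityʳ x)

∣x∣≤∣x-y∣+∣y∣ : ∀ x y → ℚ.∣ x ∣ ℚ.≤ ℚ.∣ x ℚ.- y ∣ ℚ.+ ℚ.∣ y ∣
∣x∣≤∣x-y∣+∣y∣ x y = subst (λ z → ℚ.∣ z ∣ ℚ.≤ ℚ.∣ x ℚ.- y ∣ ℚ.+ ℚ.∣ y ∣)
  (solve 2 (λ x y → (x :- y) :+ y := x) refl x y) (ℚ.∣p+q∣≤∣p∣+∣q∣ (x ℚ.- y) y)

-- Whether x is zero cannot be decided, but one late approximation can be compared with 2h for h = ε
-- / 3. From `N` on the approximations differ by less than h. If the one at `N` is below 2h in
-- absolute value, all later ones are below ε. Otherwise they stay at least h away from 0, so y is a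
-- null sequence, which is excluded.
*-cancelʳ-≈0 : ∀ x y → x *ᴿ y ≈ᴿ 0ᴿ → ¬ y ≈ᴿ 0ᴿ → x ≈ᴿ 0ᴿ
*-cancelʳ-≈0 x y xy≈0 y≉0 ε 0<ε = go (ℚ.∣ seq x N ∣ ℚ.<? h ℚ.+ h)
  where
  h : ℚ
  h = (+ 1 ℚ./ 3) ℚ.* ε
  0<h : 0ℚ ℚ.< h
  0<h = *-pos (/-pos 1 3) 0<ε
  3h : h ℚ.+ (h ℚ.+ h) ≡ ε
  3h = trans (solve 1 (λ e → con (+ 1 ℚ./ 3) :* e :+ (con (+ 1 ℚ./ 3) :* e :+ con (+ 1 ℚ./ 3) :* e) := con 1ℚ :* e) refl ε)
    (ℚ.*-identityˡ ε)
  N : ℕ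
  N = proj₁ (cauchy x h 0<h)
  close : ∀ m n → N ℕ.≤ m → N ℕ.≤ n → ℚ.∣ seq x m ℚ.- seq x n ∣ ℚ.< h
  close = proj₂ (cauchy x h 0<h)
  y≈0 : (∀ n → N ℕ.≤ n → h ℚ.≤ ℚ.∣ seq x n ∣) → y ≈ᴿ 0ᴿ
  y≈0 away ε′ 0<ε′ =
    let M , tiny = eventually-× (N , away) (xy≈0 (h ℚ.* ε′) (*-pos 0<h 0<ε′))
    in M , λ n le → subst (ℚ._< ε′) (sym (∣x-0∣ (seq y n)))
      (ℚ.*-cancelˡ-<-nonNeg h {{ℚ.nonNegative (ℚ.<⇒≤ 0<h)}}
        (ℚ.≤-<-trans (ℚ.*-monoʳ-≤-nonNeg ℚ.∣ seq y n ∣ {{ℚ.∣-∣-nonNeg (seq y n)}} (proj₁ (tiny n le)))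
          (subst (ℚ._< h ℚ.* ε′) (trans (∣x-0∣ (seq x n ℚ.* seq y n)) (ℚ.∣p*q∣≡∣p∣*∣q∣ (seq x n) (seq y n)))
            (proj₂ (tiny n le)))))
  go : Dec (ℚ.∣ seq x N ∣ ℚ.< h ℚ.+ h) → Eventually λ n → ℚ.∣ seq x n ℚ.- 0ℚ ∣ ℚ.< ε
  go (yes small) = N , λ n le → subst₂ ℚ._<_ (sym (∣x-0∣ (seq x n))) 3h
    (ℚ.≤-<-trans (∣x∣≤∣x-y∣+∣y∣ (seq x n) (seq x N)) (ℚ.+-mono-< (close n N le ℕ.≤-refl) small))
  go (no big) = ⊥-elim (y≉0 (y≈0 λ n le → ℚ.≮⇒≥ λ tiny → big
    (ℚ.≤-<-trans (∣x∣≤∣x-y∣+∣y∣ (seq x N) (seq x n)) (ℚ.+-mono-< (close N n ℕ.≤-refl le) tiny))))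

1≉0 : ¬ 1ᴿ ≈ᴿ 0ᴿ
1≉0 e = let N , lt = e 1ℚ (ℚ.positive⁻¹ 1ℚ) in ℚ.<-irrefl refl (lt N ℕ.≤-refl)

seq-sum : ∀ {N} (f : Fin N → ℝ) m → seq (sumᴿ f) m ≡ sum (λ i → seq (f i) m)
seq-sum {zero}  f m = refl
seq-sum {suc N} f m = cong (seq (f zero) m ℚ.+_) (seq-sum (f ∘ suc) m)

seq-if : ∀ b m → seq (if b then 1ᴿ else 0ᴿ) m ≡ 𝟙 b
seq-if true  m = refl
seq-if false m = refl

-- Eigenvectors of the Laplacian

does-true : ∀ {A : Set} (a? : Dec A) → does a? ≡ true → A
does-true (yes a) _ = a

bit-∧-mono : ∀ a {b c} → (b ≡ true → c ≡ true) → bit (a ∧ b) ℕ.≤ bit (a ∧ c)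
bit-∧-mono false         b⇒c = ℕ.z≤n
bit-∧-mono true  {false} b⇒c = ℕ.z≤n
bit-∧-mono true  {true}  b⇒c = ℕ.≤-reflexive (cong bit (sym (b⇒c refl)))

module Johnson (n k j : ℕ) where

  vertex : Fin (n C k) → KSubset n k
  vertex = Inverse.to (vertices n k)

  index : KSubset n k → Fin (n C k)
  index = Inverse.from (vertices n k)

  ksubset-≡ : ∀ {p q : KSubset n k} → proj₁ p ≡ proj₁ q → p ≡ q
  ksubset-≡ {S , a} {.S , b} refl = cong (S ,_) (ℕ.≡-irrelevant a b)

  swapᵏ : ℕ → KSubset n k → KSubset n k
  swapᵏ p (S , e) = swap p S , trans (∣swap∣ p S) e

  swap↔ : ℕ → KSubset n k ↔ KSubset n k
  swap↔ p = mk↔ₛ′ (swapᵏ p) (swapᵏ p) inv inv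
    where
    inv : ∀ S → swapᵏ p (swapᵏ p S) ≡ S
    inv (S , _) = ksubset-≡ (swap-involutive p S)

  π : ℕ → Permutation′ (n C k)
  π p = ↔-sym (vertices n k) ↔-∘ (swap↔ p ↔-∘ vertices n k)

  vertex-π : ∀ p v → proj₁ (vertex (π p ⟨$⟩ʳ v)) ≡ swap p (proj₁ (vertex v))
  vertex-π p v = cong proj₁ (Inverse.strictlyInverseˡ (vertices n k) (swapᵏ p (vertex v)))

  adjacent : Fin (n C k) → Fin (n C k) → Bool
  adjacent v w = does (johnsonAdjacent? n k j (vertex v) (vertex w))

  adjacent-π : ∀ p v w → adjacent (π p ⟨$⟩ʳ v) (π p ⟨$⟩ʳ w) ≡ adjacent v w
  adjacent-π p v w = cong (λ s → does (s ℕ.≟ 2 ℕ.* j)) (begin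
    ∣ proj₁ (vertex (π p ⟨$⟩ʳ v)) △ proj₁ (vertex (π p ⟨$⟩ʳ w)) ∣
      ≡⟨ cong₂ (λ S T → ∣ S △ T ∣) (vertex-π p v) (vertex-π p w) ⟩
    ∣ swap p S △ swap p T ∣ ≡⟨ cong ∣_∣ (swap-△ p S T) ⟩
    ∣ swap p (S △ T) ∣      ≡⟨ ∣swap∣ p (S △ T) ⟩
    ∣ S △ T ∣ ∎)
    where
    open ≡-Reasoning
    S T : Subset n
    S = proj₁ (vertex v)
    T = proj₁ (vertex w)

  separated : ℕ → Fin (n C k) → Bool
  separated p v = separates p (proj₁ (vertex v))

  π-fixed : ∀ p v → separated p v ≡ false → π p ⟨$⟩ʳ v ≡ v
  π-fixed p v e = trans (cong index (ksubset-≡ (swap-fixed p (proj₁ (vertex v)) e)))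
    (Inverse.strictlyInverseʳ (vertices n k) v)

  vertex-injective : Injective _≡_ _≡_ (proj₁ ∘ vertex)
  vertex-injective {v} {w} e = trans (sym (Inverse.strictlyInverseʳ (vertices n k) v))
    (trans (cong index (ksubset-≡ e)) (Inverse.strictlyInverseʳ (vertices n k) w))

  -- Adjacent vertices differ by j elements each way, and a sum over vertices is at most the sum
  -- over all subsets, which `count-separating` evaluates. As n = 2k, the vertex has k members and k
  -- non-members, and the pair takes one of each.
  degree-separated : n ≡ k ℕ.+ k → ∀ p v → separated p v ≡ true →
    ℕ∑.sum (λ w → bit (separated p w ∧ adjacent v w)) ℕ.≤ separatingDegree (ℕ.pred k) j
  degree-separated n≡2k p v e = begin
    ℕ∑.sum (λ w → bit (separated p w ∧ adjacent v w))
      ≤⟨ sum-mono term ⟩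
    ℕ∑.sum (λ w → bit (separated p w ∧ differBy S (proj₁ (vertex w)) j j))
      ≤⟨ sum-injective (proj₁ ∘ vertex) vertex-injective (λ T → bit (separates p T ∧ differBy S T j j)) ⟩
    ∑ˢ (λ T → bit (separates p T ∧ differBy S T j j))
      ≡⟨ count-separating p S j j e ⟩
    (outsBut p S C j) ℕ.* (insBut p S C j) ℕ.+ shift (outsBut p S C_) j ℕ.* shift (insBut p S C_) j
      ≡⟨ cong₂ (λ a b → (a C j) ℕ.* (b C j) ℕ.+ shift (a C_) j ℕ.* shift (b C_) j) outs≡ ins≡ ⟩
    separatingDegree (ℕ.pred k) j ∎
    where
    open ℕ.≤-Reasoning
    S : Subset n
    S = proj₁ (vertex v)
    ∣S∣≡k : ∣ S ∣ ≡ k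
    ∣S∣≡k = proj₂ (vertex v)
    ins≡ : insBut p S ≡ ℕ.pred k
    ins≡ = cong ℕ.pred (trans (sym (separates⇒∣∣ p S e)) ∣S∣≡k)
    outs≡ : outsBut p S ≡ ℕ.pred k
    outs≡ = cong ℕ.pred (trans (sym (separates⇒outs p S e))
      (ℕ.+-cancelʳ-≡ k _ _ (trans (cong (outs S ℕ.+_) (sym ∣S∣≡k)) (trans (outs+∣∣ S) n≡2k))))
    sum-mono : ∀ {N} {f g : Fin N → ℕ} → (∀ i → f i ℕ.≤ g i) → ℕ∑.sum f ℕ.≤ ℕ∑.sum g
    sum-mono {zero}  le = ℕ.z≤n
    sum-mono {suc N} le = ℕ.+-mono-≤ (le zero) (sum-mono (λ i → le (suc i)))
    term : ∀ w → bit (separated p w ∧ adjacent v w) ℕ.≤ bit (separated p w ∧ differBy S (proj₁ (vertex w)) j j)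
    term w = bit-∧-mono (separated p w) λ adj → adjacent⇒differBy S (proj₁ (vertex w))
      (trans ∣S∣≡k (sym (proj₂ (vertex w))))
      (does-true (johnsonAdjacent? n k j (vertex v) (vertex w)) adj)

  -- An exact equation at every index instead of an equality of reals: the matrix passes to `ℚ`
  -- without error, and only the eigenvector and the eigenvalue are approximated.
  IsLaplacian : ℚ → Matrix (n C k) → Set
  IsLaplacian δ M = ∀ v w m → seq (M v w) m ≡ 𝟙 (does (v Fin.≟ w)) ℚ.- δ ℚ.* 𝟙 (adjacent v w)

  module _ {δ q : ℚ} (0≤δ : 0ℚ ℚ.≤ δ) (0<q : 0ℚ ℚ.< q) (n≡2k : n ≡ k ℕ.+ k)
    (sparse : δ ℚ.* ι (separatingDegree (ℕ.pred k) j) ℚ.≤ 1ℚ ℚ.- (q ℚ.+ q ℚ.+ (q ℚ.+ q)))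
    (M : Matrix (n C k)) (M-laplacian : IsLaplacian δ M)
    {t : ℝ} (t<2q : Eventually λ m → seq t m ℚ.< q ℚ.+ q)
    {x : Vector ℝ (n C k)} (eigen : Eigenspace M t x)
    where

    eigenvector-π : ∀ p v → x v ≈ᴿ x (π p ⟨$⟩ʳ v)
    eigenvector-π p v ε 0<ε =
      -- The residual is required to be below q ε because the maximum principle bounds q times the
      -- wanted difference.
      let N , small = eventually-× t<2q (eventually-∀ λ i → eigen i (q ℚ.* ε) (*-pos 0<q 0<ε))
      in N , λ m le → ℚ.*-cancelˡ-<-nonNeg q {{ℚ.nonNegative (ℚ.<⇒≤ 0<q)}}
        (MaximumPrinciple.nearly-invariant adjacent (π p) (adjacent-π p) (separated p) (π-fixed p)
          0≤δ 0<q
          (λ i e → ℚ.≤-trans (ℚ.*-monoˡ-≤-nonNeg δ {{ℚ.nonNegative 0≤δ}} (ι-mono-≤ (degree-separated n≡2k p i e))) sparse)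
          (λ w → seq (x w) m) (proj₁ (small m le))
          (λ i → subst (λ s → ℚ.∣ s ℚ.- seq t m ℚ.* seq (x i) m ∣ ℚ.< q ℚ.* ε)
            (trans (seq-sum (λ w → M i w *ᴿ x w) m)
              (sum-cong-≗ λ w → cong (ℚ._* seq (x w) m) (M-laplacian i w m)))
            (proj₂ (small m le) i))
          v)

    eigenvector-constant : ∀ v w → x v ≈ᴿ x w
    eigenvector-constant v w = subst (λ u → x v ≈ᴿ x u) (Inverse.strictlyInverseʳ (vertices n k) w)
      -- `swap-connected` concerns bare subsets, so the predicate ranges over all proofs of the
      -- size.
      (swap-connected (λ S → ∀ e → x v ≈ᴿ x (index (S , e))) step
        (proj₁ (vertex v)) (proj₁ (vertex w)) (trans (proj₂ (vertex v)) (sym (proj₂ (vertex w))))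
        start (proj₂ (vertex w)))
      where
      start : ∀ e → x v ≈ᴿ x (index (proj₁ (vertex v) , e))
      start e = subst (λ u → x v ≈ᴿ x u)
        (sym (trans (cong index (ksubset-≡ refl)) (Inverse.strictlyInverseʳ (vertices n k) v)))
        (≈-refl {x v})
      step : ∀ p S → (∀ e → x v ≈ᴿ x (index (S , e))) → ∀ e → x v ≈ᴿ x (index (swap p S , e))
      step p S ih e = ≈-trans {x v} {x u} {x (index (swap p S , e))} (ih e′)
        (subst (λ u′ → x u ≈ᴿ x u′)
          (cong index (ksubset-≡ (cong (swap p ∘ proj₁) (Inverse.strictlyInverseˡ (vertices n k) (S , e′)))))
          (eigenvector-π p u))
        where
        e′ : ∣ S ∣ ≡ k
        e′ = trans (sym (∣swap∣ p S)) e
        u : Fin (n C k)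
        u = index (S , e′)

-- Multiplicities of eigenvalues with constant eigenvectors

¬¬-level-set : ∀ {N} (P : Fin N → Set) → ¬ ¬ ∃ λ (S : Subset N) → ∀ i → i ∈ S ⇔ P i
-- Excluded middle holds under double negation, and finitely many instances of it can be combined
-- there. This provides the subset of occurrences wherever the goal is a contradiction.
¬¬-level-set P none = Fin.sequence (RawMonad.rawApplicative ¬¬-Monad) (λ i → ¬¬-excluded-middle {A = P i}) λ P? →
  let S = tabulate (does ∘ P?)
      S≡ = lookup∘tabulate (does ∘ P?)
  in none (S , λ i → mk⇔
    (λ i∈S → does-true (P? i) (trans (sym (S≡ i)) ([]=⇒lookup i∈S)))
    (λ p → lookup⇒[]= i S (trans (S≡ i) (dec-true (P? i) p))))

0<∣S∣ : ∀ {N} {S : Subset N} {i} → i ∈ S → 0 ℕ.< ∣ S ∣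
0<∣S∣ i∈S = ℕ.≤-<-trans ℕ.z≤n (x∈p⇒∣p-x∣<∣p∣ i∈S)

1<∣S∣ : ∀ {N} {S : Subset N} {i i′} → i ≢ i′ → i ∈ S → i′ ∈ S → 1 ℕ.< ∣ S ∣
1<∣S∣ i≢i′ i∈S i′∈S = ℕ.≤-<-trans (0<∣S∣ (x∈p∧x≢y⇒x∈p-y i∈S i≢i′)) (x∈p⇒∣p-x∣<∣p∣ i′∈S)

0<dimension : ∀ {N m} {E : Vector ℝ N → Set} → 0 ℕ.< m → HasDimension E m →
              ∃ λ x → E x × ¬ (∀ v → x v ≈ᴿ 0ᴿ)
0<dimension {m = suc _} _ (b , b∈E , independent , _) =
  b zero , b∈E zero , λ b₀≈0 → 1≉0 (independent∧head≈0⇒1≈0 {b = b} independent b₀≈0)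

-- If all members were constant, two basis vectors would be proportional; this forces the first to
-- vanish at `v`, hence everywhere, against independence.
1<dimension : ∀ {N m} {E : Vector ℝ N → Set} → Fin N → 1 ℕ.< m → HasDimension E m →
              ¬ (∀ x → E x → ∀ v w → x v ≈ᴿ x w)
1<dimension {m = suc (suc _)} v _ (b , b∈E , independent , _) constant =
  1≉0 (independent∧head≈0⇒1≈0 {b = b} independent λ i →
    ≈-trans {b zero i} {b zero v} {0ᴿ} (constant (b zero) (b∈E zero) i v)
      (constant-pair-dependent {b = b} independent v
        (λ w → constant (b zero) (b∈E zero) w v)
        (λ w → constant (b (suc zero)) (b∈E (suc zero)) w v)))
1<dimension {m = suc zero} _ (ℕ.s≤s ())

-- A small eigenvalue has a constant eigenvector and so equals a row sum. Two small entries of `μ`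
-- therefore coincide and give multiplicity at least two, whereas the constant vectors span only one
-- dimension.
only-one-small-eigenvalue : ∀ {N} (M : Matrix N) (μ : Vector ℝ N) → EigenvaluesWithMultiplicity M μ →
  (Small : ℝ → Set) → (∀ {t} → Small t → ∀ x → Eigenspace M t x → ∀ v w → x v ≈ᴿ x w) →
  ∀ {i i′} → i ≢ i′ → Small (μ i) → ¬ Small (μ i′)
only-one-small-eigenvalue M μ mult Small constant {i} {i′} i≢i′ small small′ =
  ≈rowSum i small λ e → ≈rowSum i′ small′ λ e′ →
  ¬¬-level-set (λ l → μ l ≈ᴿ μ i′) λ (S , S⇔) →
  1<dimension i (1<∣S∣ i≢i′
      (Equivalence.from (S⇔ i) (≈-trans {μ i} {sumᴿ (M i)} {μ i′} e (≈-sym {μ i′} {sumᴿ (M i)} e′)))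
      (Equivalence.from (S⇔ i′) (≈-refl {μ i′})))
    (mult (μ i′) S S⇔) (constant small′)
  where
  -- Both entries are compared with the same row `i`. The cancelled factor `x i` is nonzero, since a
  -- constant vector that vanishes at `i` vanishes everywhere.
  ≈rowSum : ∀ l → Small (μ l) → ¬ ¬ μ l ≈ᴿ sumᴿ (M i)
  ≈rowSum l small ≉rowSum = ¬¬-level-set (λ l′ → μ l′ ≈ᴿ μ l) λ (S , S⇔) →
    let x , eigen , x≉0 = 0<dimension (0<∣S∣ (Equivalence.from (S⇔ l) (≈-refl {μ l}))) (mult (μ l) S S⇔)
        const = constant small x eigen
    in ≉rowSum (x-y≈0⇒x≈y (μ l) (sumᴿ (M i))
      (*-cancelʳ-≈0 (μ l -ᴿ sumᴿ (M i)) (x i)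
        (constant-eigenvector (M i) x {μ l} i (λ w → const w i) (eigen i))
        λ xi≈0 → x≉0 λ v → ≈-trans {x v} {x i} {0ᴿ} (const v i) xi≈0))

-- The degree ratio in rational form and the second eigenvalue

/-cancel-≤ : ∀ {a b} c d .{{_ : NonZero c}} .{{_ : NonZero d}} →
             + a ℚ./ c ℚ.≤ + b ℚ./ d → a ℕ.* d ℕ.≤ b ℕ.* c
/-cancel-≤ {a} {b} (suc c) (suc d) le
  with ℚᵘ.*≤* p ← ℚᵘ.≤-respˡ-≃ (ℚ.toℚᵘ-fromℚᵘ (ℚᵘ.mkℚᵘ (+ a) c))
                    (ℚᵘ.≤-respʳ-≃ (ℚ.toℚᵘ-fromℚᵘ (ℚᵘ.mkℚᵘ (+ b) d)) (ℚ.toℚᵘ-mono-≤ le)) =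
  ℤ.drop‿+≤+ (subst₂ ℤ._≤_ (sym (ℤ.pos-* a (suc d))) (sym (ℤ.pos-* b (suc c))) p)

-- `separatingDegree-bound` divided by k d: from n = 2k and η = j / n one gets j / k = 2η = 4q.
separatingDegree-ratio : ∀ n k j d .{{_ : NonZero n}} .{{_ : NonZero k}} .{{_ : NonZero d}} → d ≡ degree k j → n ≡ k ℕ.+ k →
  2 ℕ.* j ℕ.≤ k → let q = ½ ℚ.* (+ j ℚ./ n) in
  (+ 1 ℚ./ d) ℚ.* ι (separatingDegree (ℕ.pred k) j) ℚ.≤ 1ℚ ℚ.- (q ℚ.+ q ℚ.+ (q ℚ.+ q))
separatingDegree-ratio n k@(suc k-1) j d d≡ n≡2k 2j≤k = ℚ.*-cancelˡ-≤-pos (ι k) {{ℚ.positive (/-pos k 1)}} (begin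
  ι k ℚ.* (δ ℚ.* ι m)
    -- Adding and subtracting j, then writing the added one as δ d j, brings the left side of the
    -- integer bound under one factor δ.
    ≡⟨ solve 4 (λ k δ m j → k :* (δ :* m) := δ :* (k :* m) :+ j :- j) refl (ι k) δ (ι m) (ι j) ⟩
  δ ℚ.* (ι k ℚ.* ι m) ℚ.+ ι j ℚ.- ι j
    ≡⟨ cong (λ z → δ ℚ.* (ι k ℚ.* ι m) ℚ.+ z ℚ.- ι j) (sym (trans (cong (ℚ._* ι j) (/-*-ι 1 d)) (ℚ.*-identityˡ (ι j)))) ⟩
  δ ℚ.* (ι k ℚ.* ι m) ℚ.+ δ ℚ.* ι d ℚ.* ι j ℚ.- ι j
    ≡⟨ solve 5 (λ δ k m d j → δ :* (k :* m) :+ δ :* d :* j :- j := δ :* (k :* m :+ j :* d) :- j) refl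
         δ (ι k) (ι m) (ι d) (ι j) ⟩
  δ ℚ.* (ι k ℚ.* ι m ℚ.+ ι j ℚ.* ι d) ℚ.- ι j
    ≡⟨ cong (λ z → δ ℚ.* z ℚ.- ι j) (sym (trans (ι-+ (k ℕ.* m) (j ℕ.* d)) (cong₂ ℚ._+_ (ι-* k m) (ι-* j d)))) ⟩
  δ ℚ.* ι (k ℕ.* m ℕ.+ j ℕ.* d) ℚ.- ι j
    ≤⟨ ℚ.+-monoˡ-≤ (ℚ.- ι j) (ℚ.*-monoˡ-≤-nonNeg δ {{ℚ.nonNegative (ℚ.<⇒≤ (/-pos 1 d))}} (ι-mono-≤ bound)) ⟩
  δ ℚ.* ι (k ℕ.* d) ℚ.- ι j
    ≡⟨ cong (λ z → δ ℚ.* z ℚ.- ι j) (ι-* k d) ⟩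
  δ ℚ.* (ι k ℚ.* ι d) ℚ.- ι j
    ≡⟨ solve 4 (λ δ k d j → δ :* (k :* d) :- j := δ :* d :* k :- j) refl δ (ι k) (ι d) (ι j) ⟩
  δ ℚ.* ι d ℚ.* ι k ℚ.- ι j
    ≡⟨ cong₂ (λ a b → a ℚ.* ι k ℚ.- b) (/-*-ι 1 d) (sym (trans (cong (η ℚ.*_) (trans (sym (ι-+ k k)) (cong ι (sym n≡2k)))) (/-*-ι j n))) ⟩
  1ℚ ℚ.* ι k ℚ.- η ℚ.* (ι k ℚ.+ ι k)
    ≡⟨ solve 2 (λ k η → con 1ℚ :* k :- η :* (k :+ k) :=
         k :* (con 1ℚ :- (con ½ :* η :+ con ½ :* η :+ (con ½ :* η :+ con ½ :* η)))) refl (ι k) η ⟩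
  ι k ℚ.* (1ℚ ℚ.- (½ ℚ.* η ℚ.+ ½ ℚ.* η ℚ.+ (½ ℚ.* η ℚ.+ ½ ℚ.* η))) ∎)
  where
  open ℚ.≤-Reasoning
  δ η : ℚ
  δ = + 1 ℚ./ d
  η = + j ℚ./ n
  m : ℕ
  m = separatingDegree k-1 j
  bound : k ℕ.* m ℕ.+ j ℕ.* d ℕ.≤ k ℕ.* d
  bound = subst (λ d → k ℕ.* m ℕ.+ j ℕ.* d ℕ.≤ k ℕ.* d) (sym d≡) (separatingDegree-bound k-1 j 2j≤k)

-- Suppose `μ i′` is eventually below q. The order on reals bounds `μ i` only up to an error, here
-- taken to be q, which is why small means below 2q. Both entries are then small, a contradiction,
-- and `fromℚ-≤ᴿ-stable` turns this refutation into the inequality.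
laplacian-second-eigenvalue : ∀ n k j {δ q} → 0ℚ ℚ.≤ δ → 0ℚ ℚ.< q → n ≡ k ℕ.+ k →
  δ ℚ.* ι (separatingDegree (ℕ.pred k) j) ℚ.≤ 1ℚ ℚ.- (q ℚ.+ q ℚ.+ (q ℚ.+ q)) →
  (M : Matrix (n C k)) → Johnson.IsLaplacian n k j δ M →
  (μ : Vector ℝ (n C k)) → Increasing μ → EigenvaluesWithMultiplicity M μ →
  ∀ {i i′} → i Fin.≤ i′ → i ≢ i′ → fromℚ q ≤ᴿ μ i′
laplacian-second-eigenvalue n k j {δ} {q} 0≤δ 0<q n≡2k sparse M M-laplacian μ increasing mult {i} {i′} i≤i′ i≢i′ =
  fromℚ-≤ᴿ-stable q (μ i′) λ μ<q →
  only-one-small-eigenvalue M μ mult (λ t → Eventually λ m → seq t m ℚ.< q ℚ.+ q)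
    (λ {t} t<2q x eigen → eigenvector-constant 0≤δ 0<q n≡2k sparse M M-laplacian {t} t<2q {x} eigen)
    i≢i′
    (let N , lt = eventually-× (increasing i≤i′ q 0<q) μ<q
     in N , λ m le → ℚ.<-trans (proj₁ (lt m le)) (ℚ.+-monoˡ-< q (proj₂ (lt m le))))
    (let N , lt = μ<q
     in N , λ m le → ℚ.<-trans (lt m le) (subst (ℚ._< q ℚ.+ q) (ℚ.+-identityʳ q) (ℚ.+-monoʳ-< q 0<q)))
  where open Johnson n k j

normalisedLaplacian-second-eigenvalue : ∀ n j .{{_ : NonZero n}} .{{_ : NonZero j}} (j≤k : j ℕ.≤ n ℕ./ 2) →
  n ≡ n ℕ./ 2 ℕ.+ n ℕ./ 2 → 2 ℕ.* j ℕ.≤ n ℕ./ 2 →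
  (μ : Vector ℝ (n C (n ℕ./ 2))) → Increasing μ →
  EigenvaluesWithMultiplicity (normalisedLaplacian n j j≤k) μ →
  ∀ {i i′} → i Fin.≤ i′ → i ≢ i′ → fromℚ (½ ℚ.* (+ j ℚ./ n)) ≤ᴿ μ i′
normalisedLaplacian-second-eigenvalue n j j≤k n≡2k 2j≤k μ increasing mult {i} {i′} i≤i′ i≢i′ =
  laplacian-second-eigenvalue n (n ℕ./ 2) j
    (ℚ.<⇒≤ (/-pos 1 (degree (n ℕ./ 2) j))) (*-pos (/-pos 1 2) (/-pos j n)) n≡2k
    (separatingDegree-ratio n (n ℕ./ 2) j (degree (n ℕ./ 2) j) refl n≡2k 2j≤k)
    (normalisedLaplacian n j j≤k) is-laplacian μ increasing mult {i} {i′} i≤i′ i≢i′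
  where
  instance
    k≢0 : NonZero (n ℕ./ 2)
    k≢0 = ℕ.>-nonZero (ℕ.≤-trans (ℕ.>-nonZero⁻¹ j) j≤k)
    d≢0 : NonZero (degree (n ℕ./ 2) j)
    d≢0 = degree-nonZero {n ℕ./ 2} {j} j≤k
  is-laplacian : Johnson.IsLaplacian n (n ℕ./ 2) j (+ 1 ℚ./ degree (n ℕ./ 2) j) (normalisedLaplacian n j j≤k)
  is-laplacian v w m = cong₂ (λ a b → a ℚ.- (+ 1 ℚ./ degree (n ℕ./ 2) j) ℚ.* b)
    (seq-if (does (v Fin.≟ w)) m) (seq-if (Johnson.adjacent n (n ℕ./ 2) j v w) m)

theorem2 : (n j : ℕ) .{{_ : NonZero n}} .{{_ : NonZero j}} → 2 ∣ n →
    (η≤1/10 : + j ℚ./ n ℚ.≤ + 1 ℚ./ 10) →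
    (μ : Vector ℝ (n C (n ℕ./ 2))) →
    Increasing μ →
    EigenvaluesWithMultiplicity (normalisedLaplacian n j (j≤n/2 η≤1/10)) μ →
    fromℚ (½ ℚ.* (+ j ℚ./ n)) ≤ᴿ μ (fromℕ< (1<number-of-vertices η≤1/10))
theorem2 n j {{n≢0}} 2∣n η≤1/10 μ increasing mult =
  normalisedLaplacian-second-eigenvalue n j (j≤n/2 {n} {j} {{n≢0}} η≤1/10) n≡2k 2j≤k
    μ increasing mult {i₀} {i₁} i₀≤i₁ i₀≢i₁
  where
  k : ℕ
  k = n ℕ./ 2
  -- Indices start at 0, so the second eigenvalue has index 1.
  i₁ i₀ : Fin (n C (n ℕ./ 2))
  i₁ = fromℕ< (1<number-of-vertices {n} {j} η≤1/10)
  i₀ = fromℕ< (ℕ.<-trans (ℕ.s≤s ℕ.z≤n) (1<number-of-vertices {n} {j} η≤1/10))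
  toℕ-i₀ : toℕ i₀ ≡ 0
  toℕ-i₀ = Fin.toℕ-fromℕ< _
  i₀≤i₁ : i₀ Fin.≤ i₁
  i₀≤i₁ = subst (ℕ._≤ toℕ i₁) (sym toℕ-i₀) ℕ.z≤n
  i₀≢i₁ : i₀ ≢ i₁
  i₀≢i₁ e = case trans (sym toℕ-i₀) (trans (cong toℕ e) (Fin.toℕ-fromℕ< _)) of λ ()
  n≡2k : n ≡ k ℕ.+ k
  n≡2k = trans (sym (m/n*n≡m 2∣n)) (trans (ℕ.*-comm k 2) (cong (k ℕ.+_) (ℕ.+-identityʳ k)))
  -- η ≤ 1/10 gives 4j ≤ 10j ≤ n = 2k.
  2j≤k : 2 ℕ.* j ℕ.≤ k
  2j≤k = ℕ.*-cancelˡ-≤ 2 (begin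
    2 ℕ.* (2 ℕ.* j) ≡⟨ sym (ℕ.*-assoc 2 2 j) ⟩
    4 ℕ.* j         ≤⟨ ℕ.*-monoˡ-≤ j (ℕ.m≤m+n 4 6) ⟩
    10 ℕ.* j        ≡⟨ ℕ.*-comm 10 j ⟩
    j ℕ.* 10        ≤⟨ /-cancel-≤ {j} {1} n 10 η≤1/10 ⟩
    1 ℕ.* n         ≡⟨ ℕ.*-identityˡ n ⟩
    n               ≡⟨ sym (m/n*n≡m 2∣n) ⟩
    k ℕ.* 2         ≡⟨ ℕ.*-comm k 2 ⟩
    2 ℕ.* k         ∎)
    where open ℕ.≤-Reasoning
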